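{- Let $\alpha$ be a composition of $n\ge1$ and $D=S_{\omega(\alpha)}\subseteq[n-1]$. Then for every $i\ge0$, $$\hat L_\alpha^{(i)}=\sum_{E\subseteq[n+i-1]}|T(D,E)|\,L_{\omega(\mathcal{C}(E))}.$$
   Context: Compositions: finite sequences of positive integers. For $\alpha=(\alpha_1,\dots,\alpha_k)$ a composition of $n$, $S_\alpha=\{\alpha_1,\alpha_1+\alpha_2,\dots,\alpha_1+\dots+\alpha_{k-1}\}\subseteq[n-1]$; for $E=\{s_1<\dots<s_j\}\subseteq[m-1]$, $\mathcal{C}(E)=(s_1,s_2-s_1,\dots,m-s_j)$, a composition of $m$. $\omega(\alpha)$ is the composition of $n$ with $S_{\omega(\alpha)}=[n-1]\setminus S_{(\alpha_k,\dots,\alpha_1)}$. $L_\gamma$ ($\gamma$ a composition of $m$) is the fundamental quasisymmetric function $\sum x_{i_1}\cdots x_{i_m}$ over $i_1\le\dots\le i_m$ with $i_j<i_{j+1}$ whenever $j\in S_\gamma$. $\hat L_\alpha$: let $w\in\mathfrak S_n$ with descent composition $\alpha$ (i.e. $\{j:w_j>w_{j+1}\}=S_\alpha$) and chain $p_1<\dots<p_n$. A multiset-valued partition assigns to each $p_j$ a finite nonempty multiset $\sigma(p_j)$ of positive integers with $\max\sigma(p_j)\le\min\sigma(p_{j+1})$ if $w_j<w_{j+1}$ and $\max\sigma(p_j)<\min\sigma(p_{j+1})$ if $w_j>w_{j+1}$. Then $\hat L_\alpha=\sum_\sigma\prod_r x_r^{m_r(\sigma)}$, where $m_r(\sigma)$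 is the total multiplicity of $r$ in all the $\sigma(p_j)$. $\hat L_\alpha^{(i)}$ denotes the homogeneous component of $\hat L_\alpha$ of degree $n+i$. $T(D,E)$ for $D\subseteq[n-1]$, $E\subseteq[n+i-1]$: the set of injective order-preserving maps $t:[n-1]\to[n+i-1]$ with $t(D)\subseteq E$ and $E\setminus t(D)=[n+i-1]\setminus t([n-1])$. -}

module Defs where

open import Data.Nat using (ℕ; zero; suc; _+_; _*_; _∸_; _⊔_; _≤ᵇ_; _<ᵇ_; _≡ᵇ_)
open import Data.Bool using (Bool; true; false; _∧_; _∨_; not; if_then_else_)
open import Data.List using (List; []; _∷_; [_]; _++_; map; length; reverse; concatMap; upTo)
open import Data.Nat.ListAction using (sum)

range1 : ℕ → List ℕ
range1 N = map suc (upTo N)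

anyB : {A : Set} → (A → Bool) → List A → Bool
anyB p []       = false
anyB p (x ∷ xs) = p x ∨ anyB p xs

allB : {A : Set} → (A → Bool) → List A → Bool
allB p []       = true
allB p (x ∷ xs) = p x ∧ allB p xs

count : {A : Set} → (A → Bool) → List A → ℕ
count p []       = 0
count p (x ∷ xs) = if p x then suc (count p xs) else count p xs

elemᵇ : ℕ → List ℕ → Bool
elemᵇ x = anyB (x ≡ᵇ_)

iffᵇ : Bool → Bool → Bool
iffᵇ b c = (b ∧ c) ∨ (not b ∧ not c)

nth1 : {A : Set} → A → List A → ℕ → A
nth1 d []       _             = d
nth1 d (x ∷ xs) zero          = d
nth1 d (x ∷ xs) (suc zero)    = x
nth1 d (x ∷ xs) (suc (suc j)) = nth1 d xs (suc j)

words : {A : Set} → ℕ → List A → List (List A)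
words zero    xs = [ [] ]
words (suc k) xs = concatMap (λ x → map (x ∷_) (words k xs)) xs

-- all sublists (order preserved); powerset of a sorted list = its subsets as sorted lists
powerset : {A : Set} → List A → List (List A)
powerset []       = [ [] ]
powerset (x ∷ xs) = map (x ∷_) (powerset xs) ++ powerset xs

-- Compositions (lists of positive naturals) and sets (sorted lists)

descentSetFrom : ℕ → List ℕ → List ℕ
descentSetFrom acc []           = []
descentSetFrom acc (x ∷ [])     = []
descentSetFrom acc (x ∷ y ∷ ys) = (acc + x) ∷ descentSetFrom (acc + x) (y ∷ ys)

S : List ℕ → List ℕ
S = descentSetFrom 0

-- 𝒞(E) for E = {s₁<…<s_j} ⊆ [m-1] (given as a sorted list): (s₁, s₂-s₁, …, m-s_j)
compFrom : ℕ → ℕ → List ℕ → List ℕ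
compFrom m prev []       = (m ∸ prev) ∷ []
compFrom m prev (s ∷ ss) = (s ∸ prev) ∷ compFrom m s ss

𝒞 : ℕ → List ℕ → List ℕ
𝒞 m E = compFrom m 0 E

ω : List ℕ → List ℕ
ω α = 𝒞 n (complement (range1 (n ∸ 1)))
  where
  n = sum α
  complement : List ℕ → List ℕ
  complement []       = []
  complement (j ∷ js) = if elemᵇ j (S (reverse α)) then complement js else j ∷ complement js

-- Monomials: a : List ℕ stands for x₁^{a₁} x₂^{a₂} ⋯ x_k^{a_k} (k = length a).
-- A (quasisymmetric) formal power series is determined by its coefficients.

occ : ℕ → List ℕ → ℕ
occ r w = count (r ≡ᵇ_) w

-- coefficient of x^a in L_γ: the number of i₁ ≤ … ≤ i_m (m = |γ|) with
-- i_j < i_{j+1} for j ∈ S_γ and x_{i₁}⋯x_{i_m} = x^a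
-- (indices > length a cannot occur in such a monomial, so i_j ∈ [length a]).
coeffL : List ℕ → List ℕ → ℕ
coeffL γ a = count ok (words m (range1 (length a)))
  where
  m = sum γ
  ok : List ℕ → Bool
  ok w = allB (λ j → if elemᵇ j (S γ)
                       then nth1 0 w j <ᵇ nth1 0 w (suc j)
                       else nth1 0 w j ≤ᵇ nth1 0 w (suc j)) (range1 (m ∸ 1))
         ∧ allB (λ r → occ r w ≡ᵇ nth1 0 a r) (range1 (length a))

-- A finite multiset of positive integers whose elements lie in [k] is
-- represented by its multiplicity list (b₁,…,b_k) (b_r = multiplicity of r).
-- boxes a = all multiplicity lists b with b_r ≤ a_r.
boxes : List ℕ → List (List ℕ)
boxes []       = [ [] ]
boxes (x ∷ xs) = concatMap (λ c → map (c ∷_) (boxes xs)) (upTo (suc x))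

nonemptyM : List ℕ → Bool
nonemptyM = anyB (0 <ᵇ_)

minFrom : ℕ → List ℕ → ℕ
minFrom r []       = 0
minFrom r (x ∷ xs) = if 0 <ᵇ x then r else minFrom (suc r) xs

minM : List ℕ → ℕ
minM = minFrom 1

maxFrom : ℕ → List ℕ → ℕ
maxFrom r []       = 0
maxFrom r (x ∷ xs) = (if 0 <ᵇ x then r else 0) ⊔ maxFrom (suc r) xs

maxM : List ℕ → ℕ
maxM = maxFrom 1

-- coefficient of x^a in L̂_α: number of multiset-valued partitions σ of the
-- chain p₁<…<p_n (n = |α|), for w of descent set S_α (so w_j > w_{j+1} iff
-- j ∈ S_α), with ∏_r x_r^{m_r(σ)} = x^a.  σ is the list (σ(p₁),…,σ(p_n)).
coeffLhat : List ℕ → List ℕ → ℕ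
coeffLhat α a = count ok (words n (boxes a))
  where
  n = sum α
  ok : List (List ℕ) → Bool
  ok σ = allB nonemptyM σ
         ∧ allB (λ j → if elemᵇ j (S α)
                         then maxM (nth1 [] σ j) <ᵇ minM (nth1 [] σ (suc j))
                         else maxM (nth1 [] σ j) ≤ᵇ minM (nth1 [] σ (suc j))) (range1 (n ∸ 1))
         ∧ allB (λ r → sum (map (λ b → nth1 0 b r) σ) ≡ᵇ nth1 0 a r) (range1 (length a))

coeffLhatDeg : ℕ → List ℕ → List ℕ → ℕ
coeffLhatDeg i α a = if sum a ≡ᵇ (sum α + i) then coeffLhat α a else 0

-- |T(D,E)| for D ⊆ [n-1], E ⊆ [n+i-1]; a map t : [n-1] → [n+i-1] is
-- the word (t(1),…,t(n-1)).
Tcount : ℕ → ℕ → List ℕ → List ℕ → ℕ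
Tcount n i D E = count ok (words (n ∸ 1) (range1 (n + i ∸ 1)))
  where
  dom = range1 (n ∸ 1)
  ok : List ℕ → Bool
  ok t = allB (λ j → allB (λ j' → if t' j ≡ᵇ t' j' then j ≡ᵇ j' else true) dom) dom
         ∧ allB (λ j → allB (λ j' → if j <ᵇ j' then t' j ≤ᵇ t' j' else true) dom) dom
         ∧ allB (λ d → elemᵇ (t' d) E) D
         ∧ allB (λ x → iffᵇ (elemᵇ x E ∧ not (elemᵇ x (map t' D))) (not (elemᵇ x (map t' dom))))
                (range1 (n + i ∸ 1))
    where
    t' : ℕ → ℕ
    t' = nth1 0 t

coeffRHS : ℕ → ℕ → List ℕ → List ℕ → ℕ
coeffRHS n i D a =
  sum (map (λ E → Tcount n i D E * coeffL (ω (𝒞 (n + i) E)) a) (powerset (range1 (n + i ∸ 1))))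

-- The entries of a multiset-valued partition σ of content a, written out in order, form the
-- unique weakly increasing word W of content a, so σ amounts to a choice of n ∸ 1 cut
-- positions in W, where W must ascend strictly at the j-th cut if j ∈ S α.  Put t(k) = the
-- total size of the last k parts of σ, so that the (n ∸ k)-th cut lies at position
-- m ∸ t(k), with m = n + i.  A map t ∈ T(D,E) determines E as the complement of
-- t([n ∸ 1] ∖ D), and L_{ω(𝒞 E)} contributes 1 to the coefficient of x^a exactly when W
-- ascends strictly at m ∸ e for all e ∉ E.  As k ∉ D means n ∸ k ∈ S α, these are the same
-- conditions, so σ ↦ (E, t, W) is a bijection.
module Submission where

open import Defs
open import Data.Bool using (Bool; true; false; _∧_; not; if_then_else_; T)
open import Data.Bool.Properties using (T-∧; T-∨; T?)
open import Data.Empty using (⊥-elim)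
open import Data.List
  using (List; []; _∷_; [_]; _++_; map; length; concat; concatMap; reverse; upTo; applyUpTo;
         replicate; take; drop; filterᵇ; cartesianProduct; cartesianProductWith)
open import Data.List.Membership.Propositional using (_∈_; _∉_)
open import Data.List.Membership.Propositional.Properties
open import Data.List.Membership.Propositional.Properties.WithK using (unique∧set⇒bag)
open import Data.List.Properties
  using (length-map; length-++; length-replicate; length-drop; length-reverse; length-upTo;
         reverse-++; reverse-involutive; take++drop≡id; map-∘; map-upTo; map-id-local;
         map-cong-local; ++-identityʳ; ∷-injective)
open import Data.List.Relation.Binary.BagAndSetEquality using (∼bag⇒↭)
open import Data.List.Relation.Binary.Permutation.Propositional.Properties using (↭-length; ↭-reverse)
open import Data.List.Relation.Binary.Pointwise using (Pointwise; []; _∷_; Pointwise-length)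
open import Data.List.Relation.Unary.All as All using (All; []; _∷_)
import Data.List.Relation.Unary.All.Properties as All
open import Data.List.Relation.Unary.AllPairs using (AllPairs; []; _∷_)
import Data.List.Relation.Unary.AllPairs.Properties as AllPairs
open import Data.List.Relation.Unary.Any using (here; there)
open import Data.List.Relation.Unary.Linked using (Linked; []; [-]; _∷_)
open import Data.List.Relation.Unary.Linked.Properties using (Linked⇒AllPairs)
open import Data.List.Relation.Unary.Unique.Propositional using (Unique)
import Data.List.Relation.Unary.Unique.Propositional.Properties as Unique
open import Data.Nat
open import Data.Nat.ListAction using (sum)
open import Data.Nat.ListAction.Properties using (sum-↭; sum-++)
open import Data.Nat.Properties
open import Data.Product using (∃; ∃₂; _×_; _,_; proj₁; proj₂)
open import Data.Sum using (_⊎_; inj₁; inj₂)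
open import Function using (_∘_; id; mk⇔; Equivalence)
open import Relation.Binary.Definitions using (tri<; tri≈; tri>)
open import Relation.Binary.PropositionalEquality hiding ([_])
open import Relation.Nullary using (¬_; yes; no)
open Equivalence using (to; from)

-- Counting starts at the end of the chain because ω reflects: `S (ω β)` consists of the x in range
-- for which |β| - x is not in `S β`. This reflection enters twice, on [n - 1] through D and on
-- [m - 1] through the descents of ω(𝒞(E)), and measuring parts from the right makes the two cancel.
-- Two mismatches of form remain. The right-hand side is a sum of products of counts, so it is first
-- turned into a single count of triples (E, t, w), in which w is forced to be W and E is forced by
-- t. And the parts of σ are multiplicity lists, whereas cuts live in words; `expand` passes from
-- the former to the latter and turns the extremes of a multiset into first and last letters.

private variable
  A B C : Set

-- Counting and enumeration

count-length : (p : A → Bool) (xs : List A) → count p xs ≡ length (filterᵇ p xs)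
count-length p []       = refl
count-length p (x ∷ xs) with p x
... | true  = cong suc (count-length p xs)
... | false = count-length p xs

Unique-map⁺ : (f : A → B) {xs : List A} →
  (∀ {x x′} → x ∈ xs → x′ ∈ xs → f x ≡ f x′ → x ≡ x′) → Unique xs → Unique (map f xs)
Unique-map⁺ f inj []       = []
Unique-map⁺ f inj (x≢ ∷ u) =
  All.map⁺ (All.tabulate λ y∈ eq → All.lookup x≢ y∈ (inj (here refl) (there y∈) eq))
  ∷ Unique-map⁺ f (λ x∈ y∈ → inj (there x∈) (there y∈)) u

-- Both filtered lists are free of repetitions and, after mapping `f`, have the same members, so
-- they are permutations of each other. Injectivity is asked only on entries passing `p`: suffix
-- sizes determine σ only once its content is fixed.
count-bijection : {p : A → Bool} {q : B → Bool} {xs : List A} {ys : List B} →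
  Unique xs → Unique ys → (f : A → B) →
  (∀ {x} → x ∈ xs → T (p x) → f x ∈ ys × T (q (f x))) →
  (∀ {x x′} → x ∈ xs → T (p x) → x′ ∈ xs → T (p x′) → f x ≡ f x′ → x ≡ x′) →
  (∀ {y} → y ∈ ys → T (q y) → ∃ λ x → x ∈ xs × T (p x) × f x ≡ y) →
  count p xs ≡ count q ys
count-bijection {p = p} {q} {xs} {ys} uxs uys f to inj onto = begin
  count p xs                       ≡⟨ count-length p xs ⟩
  length (filterᵇ p xs)            ≡⟨ length-map f (filterᵇ p xs) ⟨
  length (map f (filterᵇ p xs))    ≡⟨ ↭-length (∼bag⇒↭ (unique∧set⇒bag unique₁ unique₂ (mk⇔ ⊆₁ ⊆₂))) ⟩
  length (filterᵇ q ys)            ≡⟨ count-length q ys ⟨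
  count q ys                       ∎
  where
  open ≡-Reasoning
  unfilter : ∀ {x} → x ∈ filterᵇ p xs → x ∈ xs × T (p x)
  unfilter = ∈-filter⁻ (T? ∘ p) {xs = xs}
  unique₁ : Unique (map f (filterᵇ p xs))
  unique₁ = Unique-map⁺ f
    (λ x∈ y∈ → let x∈xs , px = unfilter x∈ ; y∈xs , py = unfilter y∈ in inj x∈xs px y∈xs py)
    (Unique.filter⁺ (T? ∘ p) uxs)
  unique₂ : Unique (filterᵇ q ys)
  unique₂ = Unique.filter⁺ (T? ∘ q) uys
  ⊆₁ : ∀ {y} → y ∈ map f (filterᵇ p xs) → y ∈ filterᵇ q ys
  ⊆₁ y∈ with x , x∈ , refl ← ∈-map⁻ f y∈ =
    let x∈xs , px = unfilter x∈ ; fx∈ , qfx = to x∈xs px in ∈-filter⁺ (T? ∘ q) fx∈ qfx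
  ⊆₂ : ∀ {y} → y ∈ filterᵇ q ys → y ∈ map f (filterᵇ p xs)
  ⊆₂ y∈ =
    let y∈ys , qy = ∈-filter⁻ (T? ∘ q) {xs = ys} y∈ ; x , x∈ , px , fx≡y = onto y∈ys qy
    in subst (_∈ map f (filterᵇ p xs)) fx≡y (∈-map⁺ f (∈-filter⁺ (T? ∘ p) x∈ px))

count-none : {p : A → Bool} (xs : List A) → (∀ {x} → x ∈ xs → ¬ T (p x)) → count p xs ≡ 0
count-none         []       none = refl
count-none {p = p} (x ∷ xs) none with p x | none (here refl)
... | true  | ¬t = ⊥-elim (¬t _)
... | false | _  = count-none xs (none ∘ there)

count-++ : (p : A → Bool) (xs ys : List A) → count p (xs ++ ys) ≡ count p xs + count p ys
count-++ p []       ys = refl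
count-++ p (x ∷ xs) ys with p x
... | true  = cong suc (count-++ p xs ys)
... | false = count-++ p xs ys

count-map : (p : B → Bool) (f : A → B) (xs : List A) → count p (map f xs) ≡ count (p ∘ f) xs
count-map p f []       = refl
count-map p f (x ∷ xs) with p (f x)
... | true  = cong suc (count-map p f xs)
... | false = count-map p f xs

count-fibres : (P : A → B → Bool) (xs : List A) (ys : List B) →
  count (λ (x , y) → P x y) (cartesianProduct xs ys) ≡ sum (map (λ x → count (P x) ys) xs)
count-fibres P []       ys = refl
count-fibres P (x ∷ xs) ys = trans (count-++ _ (map (x ,_) ys) _)
  (cong₂ _+_ (count-map _ (x ,_) ys) (count-fibres P xs ys))

count-× : (p : A → Bool) (q : B → Bool) (xs : List A) (ys : List B) →
  count (λ (x , y) → p x ∧ q y) (cartesianProduct xs ys) ≡ count p xs * count q ys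
count-× p q xs ys = trans (count-fibres (λ x y → p x ∧ q y) xs ys) (go xs)
  where
  go : ∀ xs → sum (map (λ x → count (λ y → p x ∧ q y) ys) xs) ≡ count p xs * count q ys
  go []       = refl
  go (x ∷ xs) with p x
  ... | true  = cong (count q ys +_) (go xs)
  ... | false = cong₂ _+_ (count-none ys (λ _ ())) (go xs)

allB⁺ : {p : A → Bool} (xs : List A) → (∀ {x} → x ∈ xs → T (p x)) → T (allB p xs)
allB⁺ []       h = _
allB⁺ (x ∷ xs) h = from T-∧ (h (here refl) , allB⁺ xs (h ∘ there))

allB⁻ : {p : A → Bool} (xs : List A) → T (allB p xs) → ∀ {x} → x ∈ xs → T (p x)
allB⁻ (x ∷ xs) h (here refl) = proj₁ (to T-∧ h)
allB⁻ (x ∷ xs) h (there x∈)  = allB⁻ xs (proj₂ (to T-∧ h)) x∈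

elemᵇ⁺ : ∀ {x xs} → x ∈ xs → T (elemᵇ x xs)
elemᵇ⁺ {x} (here refl) = from T-∨ (inj₁ (≡⇒≡ᵇ x x refl))
elemᵇ⁺     (there x∈)  = from T-∨ (inj₂ (elemᵇ⁺ x∈))

elemᵇ⁻ : ∀ {x} xs → T (elemᵇ x xs) → x ∈ xs
elemᵇ⁻ {x} (y ∷ xs) h with x ≡ᵇ y in eq
... | true  = here (≡ᵇ⇒≡ x y (subst T (sym eq) _))
... | false = there (elemᵇ⁻ xs h)

T-not⁺ : ∀ {b} → ¬ T b → T (not b)
T-not⁺ {true}  h = h _
T-not⁺ {false} h = _

T-not⁻ : ∀ {b} → T (not b) → ¬ T b
T-not⁻ {false} _ ()

T-iffᵇ⁺ : ∀ {b c} → (T b → T c) → (T c → T b) → T (iffᵇ b c)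
T-iffᵇ⁺ {true}  {true}  f g = _
T-iffᵇ⁺ {true}  {false} f g = f _
T-iffᵇ⁺ {false} {true}  f g = g _
T-iffᵇ⁺ {false} {false} f g = _

T-iffᵇ⁻ : ∀ {b c} → T (iffᵇ b c) → (T b → T c) × (T c → T b)
T-iffᵇ⁻ {true}  {true}  h = id , id
T-iffᵇ⁻ {false} {false} h = id , id

T-injective : ∀ {b c} → (T b → T c) → (T c → T b) → b ≡ c
T-injective {true}  {true}  f g = refl
T-injective {true}  {false} f g = ⊥-elim (f _)
T-injective {false} {true}  f g = ⊥-elim (g _)
T-injective {false} {false} f g = refl

∈-range1⁺ : ∀ {N x} → 1 ≤ x → x ≤ N → x ∈ range1 N
∈-range1⁺ {x = suc x} _ x≤N = ∈-map⁺ suc (∈-upTo⁺ x≤N)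

∈-range1⁻ : ∀ {N x} → x ∈ range1 N → 1 ≤ x × x ≤ N
∈-range1⁻ x∈ with y , y∈ , refl ← ∈-map⁻ suc x∈ = s≤s z≤n , ∈-upTo⁻ y∈

range1-unique : ∀ N → Unique (range1 N)
range1-unique N = Unique.map⁺ suc-injective (Unique.upTo⁺ N)

-- Presents `words` and `boxes` as products, to which the facts on membership and uniqueness in
-- products apply.
concatMap-map : (f : A → B → C) (xs : List A) (ys : List B) →
  concatMap (λ x → map (f x) ys) xs ≡ cartesianProductWith f xs ys
concatMap-map f []       ys = refl
concatMap-map f (x ∷ xs) ys = cong (map (f x) ys ++_) (concatMap-map f xs ys)

words-unique : (k : ℕ) {xs : List A} → Unique xs → Unique (words k xs)
words-unique zero    u = [] ∷ []
words-unique (suc k) {xs} u = subst Unique (sym (concatMap-map _∷_ xs (words k xs)))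
  (Unique.cartesianProductWith⁺ _∷_ ∷-injective u (words-unique k u))

∈-words⁺ : {xs w : List A} → All (_∈ xs) w → w ∈ words (length w) xs
∈-words⁺ [] = here refl
∈-words⁺ {xs = xs} {w = x ∷ w} (x∈ ∷ w∈) =
  subst (x ∷ w ∈_) (sym (concatMap-map _∷_ xs (words (length w) xs)))
    (∈-cartesianProductWith⁺ _∷_ x∈ (∈-words⁺ w∈))

∈-words⁻ : (k : ℕ) {xs w : List A} → w ∈ words k xs → length w ≡ k × All (_∈ xs) w
∈-words⁻ zero    (here refl) = refl , []
∈-words⁻ (suc k) {xs} {w} w∈
  with x , v , x∈ , v∈ , refl ← ∈-cartesianProductWith⁻ _∷_ xs (words k xs)
         (subst (w ∈_) (concatMap-map _∷_ xs (words k xs)) w∈) =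
  let |v| , v⊆ = ∈-words⁻ k v∈ in cong suc |v| , x∈ ∷ v⊆

boxes-unique : (a : List ℕ) → Unique (boxes a)
boxes-unique []      = [] ∷ []
boxes-unique (x ∷ a) = subst Unique (sym (concatMap-map _∷_ (upTo (suc x)) (boxes a)))
  (Unique.cartesianProductWith⁺ _∷_ ∷-injective (Unique.upTo⁺ (suc x)) (boxes-unique a))

∈-boxes⁺ : ∀ {a b} → Pointwise _≤_ b a → b ∈ boxes a
∈-boxes⁺ []        = here refl
∈-boxes⁺ {x ∷ a} {y ∷ b} (y≤x ∷ b≤a) =
  subst (y ∷ b ∈_) (sym (concatMap-map _∷_ (upTo (suc x)) (boxes a)))
    (∈-cartesianProductWith⁺ _∷_ (∈-upTo⁺ (s≤s y≤x)) (∈-boxes⁺ b≤a))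

∈-boxes⁻ : ∀ {a b} → b ∈ boxes a → Pointwise _≤_ b a
∈-boxes⁻ {[]}    (here refl) = []
∈-boxes⁻ {x ∷ a} {b} b∈
  with y , b′ , y∈ , b′∈ , refl ← ∈-cartesianProductWith⁻ _∷_ (upTo (suc x)) (boxes a)
         (subst (b ∈_) (concatMap-map _∷_ (upTo (suc x)) (boxes a)) b∈) =
  s≤s⁻¹ (∈-upTo⁻ y∈) ∷ ∈-boxes⁻ b′∈

filterᵇ-cong : {p q : A → Bool} (xs : List A) → (∀ {x} → x ∈ xs → p x ≡ q x) →
  filterᵇ p xs ≡ filterᵇ q xs
filterᵇ-cong []       h = refl
filterᵇ-cong {p = p} {q} (x ∷ xs) h with p x | q x | h (here refl)
... | true  | _ | refl = cong (x ∷_) (filterᵇ-cong xs (h ∘ there))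
... | false | _ | refl = filterᵇ-cong xs (h ∘ there)

filterᵇ∈powerset : (p : A → Bool) (xs : List A) → filterᵇ p xs ∈ powerset xs
filterᵇ∈powerset p []       = here refl
filterᵇ∈powerset p (x ∷ xs) with p x
... | true  = ∈-++⁺ˡ (∈-map⁺ (x ∷_) (filterᵇ∈powerset p xs))
... | false = ∈-++⁺ʳ _ (filterᵇ∈powerset p xs)

∈-powerset⇒⊆ : (xs : List A) {E : List A} → E ∈ powerset xs → ∀ {x} → x ∈ E → x ∈ xs
∈-powerset⇒⊆ []       (here refl) ()
∈-powerset⇒⊆ (y ∷ xs) E∈ x∈ with ∈-++⁻ (map (y ∷_) (powerset xs)) E∈
... | inj₂ E∈′ = there (∈-powerset⇒⊆ xs E∈′ x∈)
... | inj₁ E∈′ with E′ , E′∈ , refl ← ∈-map⁻ (y ∷_) E∈′ | x∈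
...   | here refl = here refl
...   | there x∈′ = there (∈-powerset⇒⊆ xs E′∈ x∈′)

powerset-unique : {xs : List A} → Unique xs → Unique (powerset xs)
powerset-unique []       = [] ∷ []
powerset-unique {xs = x ∷ xs} (x∉ ∷ u) =
  Unique.++⁺ (Unique.map⁺ (proj₂ ∘ ∷-injective) (powerset-unique u)) (powerset-unique u)
    λ (E∈₁ , E∈₂) → disjoint E∈₁ E∈₂
  where
  disjoint : ∀ {E} → E ∈ map (x ∷_) (powerset xs) → ¬ E ∈ powerset xs
  disjoint E∈₁ E∈₂ with _ , _ , refl ← ∈-map⁻ (x ∷_) E∈₁ =
    All.lookup x∉ (∈-powerset⇒⊆ xs E∈₂ (here refl)) refl

-- A sublist of a list without repetitions is recovered from its members. Hence every E has a
-- filtered form, which inherits the order of the ambient list, and sublists with the same members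
-- are equal.
∈-powerset⇒filterᵇ : {xs E : List ℕ} → Unique xs → E ∈ powerset xs →
  E ≡ filterᵇ (λ x → elemᵇ x E) xs
∈-powerset⇒filterᵇ [] (here refl) = refl
∈-powerset⇒filterᵇ {y ∷ xs} {E} (y∉ ∷ u) E∈ with ∈-++⁻ (map (y ∷_) (powerset xs)) E∈
... | inj₂ E∈′ with elemᵇ y E in eq
...   | true  = ⊥-elim (All.lookup y∉ (∈-powerset⇒⊆ xs E∈′ (elemᵇ⁻ E (subst T (sym eq) _))) refl)
...   | false = ∈-powerset⇒filterᵇ u E∈′
∈-powerset⇒filterᵇ {y ∷ xs} {E} (y∉ ∷ u) E∈ | inj₁ E∈′
  with E′ , E′∈ , refl ← ∈-map⁻ (y ∷_) E∈′ with y ≡ᵇ y in eq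
... | false = ⊥-elim (subst T eq (≡⇒≡ᵇ y y refl))
... | true  = cong (y ∷_) (trans (∈-powerset⇒filterᵇ u E′∈) (filterᵇ-cong xs same))
  where
  same : ∀ {x} → x ∈ xs → elemᵇ x E′ ≡ elemᵇ x (y ∷ E′)
  same {x} x∈ = T-injective (λ h → elemᵇ⁺ {x} {y ∷ E′} (there (elemᵇ⁻ E′ h))) back
    where
    back : T (elemᵇ x (y ∷ E′)) → T (elemᵇ x E′)
    back h with elemᵇ⁻ {x} (y ∷ E′) h
    ... | here refl = ⊥-elim (All.lookup y∉ x∈ refl)
    ... | there x∈′ = elemᵇ⁺ x∈′

-- Descent sets and the involution ω

Increasing : List ℕ → Set
Increasing = AllPairs _<_

range1-increasing : ∀ N → Increasing (range1 N)
range1-increasing N = AllPairs.map⁺ (AllPairs.applyUpTo⁺₁ id N (λ i<j _ → s≤s i<j))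

range1-below : ∀ m {x} → x ∈ range1 (m ∸ 1) → 1 ≤ x × x < m
range1-below zero    x∈ with () ← x∈
range1-below (suc m) x∈ = let 1≤x , x≤m = ∈-range1⁻ x∈ in 1≤x , s≤s x≤m

-- `acc` is the partial sum reached so far, so adding s - acc restores s; the increase keeps the
-- truncated subtraction exact.
S-compFrom : ∀ m acc {E} → Increasing (acc ∷ E) → descentSetFrom acc (compFrom m acc E) ≡ E
S-compFrom m acc {[]}         _ = refl
S-compFrom m acc {s ∷ []}     ((acc<s ∷ _) ∷ inc) =
  cong (_∷ []) (m+[n∸m]≡n (<⇒≤ acc<s))
S-compFrom m acc {s ∷ s′ ∷ E} ((acc<s ∷ _) ∷ inc)
  rewrite m+[n∸m]≡n (<⇒≤ acc<s) = cong (s ∷_) (S-compFrom m s inc)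

sum-compFrom : ∀ m acc {E} → Increasing (acc ∷ E) → All (_< m) E → sum (compFrom m acc E) ≡ m ∸ acc
sum-compFrom m acc {[]}    _ _ = +-identityʳ (m ∸ acc)
sum-compFrom m acc {s ∷ E} ((acc<s ∷ _) ∷ inc) (s<m ∷ E<m) = begin
  (s ∸ acc) + sum (compFrom m s E)  ≡⟨ cong ((s ∸ acc) +_) (sum-compFrom m s inc E<m) ⟩
  (s ∸ acc) + (m ∸ s)               ≡⟨ +-comm (s ∸ acc) (m ∸ s) ⟩
  (m ∸ s) + (s ∸ acc)               ≡⟨ +-∸-assoc (m ∸ s) (<⇒≤ acc<s) ⟨
  (m ∸ s + s) ∸ acc                 ≡⟨ cong (_∸ acc) (m∸n+n≡m (<⇒≤ s<m)) ⟩
  m ∸ acc                           ∎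
  where open ≡-Reasoning

module _ (m : ℕ) (p : ℕ → Bool) where
  private
    E : List ℕ
    E = filterᵇ p (range1 (m ∸ 1))

    below : ∀ {x} → x ∈ E → 1 ≤ x × x < m
    below x∈ = range1-below m (proj₁ (∈-filter⁻ (T? ∘ p) {xs = range1 (m ∸ 1)} x∈))

    inc : Increasing (0 ∷ E)
    inc = All.tabulate (proj₁ ∘ below) ∷ AllPairs.filter⁺ (T? ∘ p) (range1-increasing (m ∸ 1))

  S-𝒞 : S (𝒞 m E) ≡ E
  S-𝒞 = S-compFrom m 0 inc

  sum-𝒞 : sum (𝒞 m E) ≡ m
  sum-𝒞 = sum-compFrom m 0 inc (All.tabulate (proj₂ ∘ below))

-- Membership in a descent set as a factorization into two nonempty factors. Unlike the running sums
-- of `descentSetFrom`, this form is symmetric under reversal.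
IsCut : ℕ → List ℕ → Set
IsCut j β = ∃₂ λ β₁ β₂ → β ≡ β₁ ++ β₂ × 1 ≤ length β₁ × 1 ≤ length β₂ × j ≡ sum β₁

descentSetFrom⇒IsCut : ∀ acc β {j} → j ∈ descentSetFrom acc β → ∃ λ k → j ≡ acc + k × IsCut k β
descentSetFrom⇒IsCut acc (x ∷ y ∷ ys) (here refl) =
  x , refl , [ x ] , y ∷ ys , refl , s≤s z≤n , s≤s z≤n , sym (+-identityʳ x)
descentSetFrom⇒IsCut acc (x ∷ y ∷ ys) (there j∈)
  with k , refl , β₁ , β₂ , eq , _ , 1≤β₂ , refl ← descentSetFrom⇒IsCut (acc + x) (y ∷ ys) j∈ =
  x + k , +-assoc acc x k , x ∷ β₁ , β₂ , cong (x ∷_) eq , s≤s z≤n , 1≤β₂ , refl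

descentSetFrom-++ : ∀ acc x xs y ys →
  acc + sum (x ∷ xs) ∈ descentSetFrom acc ((x ∷ xs) ++ y ∷ ys)
descentSetFrom-++ acc x []        y ys = here (cong (acc +_) (+-identityʳ x))
descentSetFrom-++ acc x (x′ ∷ xs) y ys =
  there (subst (_∈ descentSetFrom (acc + x) ((x′ ∷ xs) ++ y ∷ ys))
    (+-assoc acc x (sum (x′ ∷ xs))) (descentSetFrom-++ (acc + x) x′ xs y ys))

∈-S⇒IsCut : ∀ {β j} → j ∈ S β → IsCut j β
∈-S⇒IsCut {β} j∈ with _ , refl , cut ← descentSetFrom⇒IsCut 0 β j∈ = cut

IsCut⇒∈-S : ∀ {β j} → IsCut j β → j ∈ S β
IsCut⇒∈-S (x ∷ xs , y ∷ ys , refl , _ , _ , refl) = descentSetFrom-++ 0 x xs y ys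

sum-reverse : ∀ β → sum (reverse β) ≡ sum β
sum-reverse β = sum-↭ (↭-reverse β)

-- Reversal exchanges the two factors, so the new prefix sum is what `β₁` leaves of the total.
IsCut-reverse : ∀ {β j} → IsCut j β → IsCut (sum β ∸ j) (reverse β)
IsCut-reverse (β₁ , β₂ , refl , 1≤β₁ , 1≤β₂ , refl) =
  reverse β₂ , reverse β₁ , reverse-++ β₁ β₂ ,
  subst (1 ≤_) (sym (length-reverse β₂)) 1≤β₂ ,
  subst (1 ≤_) (sym (length-reverse β₁)) 1≤β₁ ,
  (begin
    sum (β₁ ++ β₂) ∸ sum β₁      ≡⟨ cong (_∸ sum β₁) (sum-++ β₁ β₂) ⟩
    sum β₁ + sum β₂ ∸ sum β₁     ≡⟨ m+n∸m≡n (sum β₁) (sum β₂) ⟩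
    sum β₂                       ≡⟨ sum-reverse β₂ ⟨
    sum (reverse β₂)             ∎)
  where open ≡-Reasoning

∈-S-reverse⁺ : ∀ {β x} → x ≤ sum β → sum β ∸ x ∈ S β → x ∈ S (reverse β)
∈-S-reverse⁺ {β} x≤ x∈ = subst (_∈ S (reverse β)) (m∸[m∸n]≡n x≤)
  (IsCut⇒∈-S (IsCut-reverse (∈-S⇒IsCut x∈)))

∈-S-reverse⁻ : ∀ {β x} → x ∈ S (reverse β) → sum β ∸ x ∈ S β
∈-S-reverse⁻ {β} {x} x∈ = IsCut⇒∈-S (subst₂ IsCut (cong (_∸ x) (sum-reverse β))
  (reverse-involutive β) (IsCut-reverse (∈-S⇒IsCut x∈)))

-- The left-hand side is solved, when ω-filter is checked, to the local function by
-- which ω takes complements; that function cannot be named here.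
complement-filter : ∀ α js → _ ≡ filterᵇ (λ j → not (elemᵇ j (S (reverse α)))) js
ω-filter : ∀ α → ω α ≡ 𝒞 (sum α) (filterᵇ (λ j → not (elemᵇ j (S (reverse α)))) (range1 (sum α ∸ 1)))
ω-filter α with range1 (sum α ∸ 1)
... | js = cong (𝒞 (sum α)) (complement-filter α js)
complement-filter α []       = refl
complement-filter α (j ∷ js) with elemᵇ j (S (reverse α))
... | true  = complement-filter α js
... | false = cong (j ∷_) (complement-filter α js)

sum-ω : ∀ β → sum (ω β) ≡ sum β
sum-ω β = trans (cong sum (ω-filter β)) (sum-𝒞 (sum β) _)

S-ω : ∀ β → S (ω β) ≡ filterᵇ (λ j → not (elemᵇ j (S (reverse β)))) (range1 (sum β ∸ 1))
S-ω β = trans (cong S (ω-filter β)) (S-𝒞 (sum β) _)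

-- The reversal inside ω reflects the descent set before the complement is taken. Apart from the sum
-- of ω(β), this and its converse are all that is used about ω.
∈-S-ω⁺ : ∀ {β x} → 1 ≤ x → x < sum β → sum β ∸ x ∉ S β → x ∈ S (ω β)
∈-S-ω⁺ {β} {x} 1≤x x<N x∉ = subst (x ∈_) (sym (S-ω β))
  (∈-filter⁺ (T? ∘ _) (∈-range1⁺ 1≤x (<⇒≤pred x<N))
    (T-not⁺ (x∉ ∘ ∈-S-reverse⁻ ∘ elemᵇ⁻ {x} (S (reverse β)))))

∈-S-ω⁻ : ∀ {β x} → x ∈ S (ω β) → 1 ≤ x × x < sum β × sum β ∸ x ∉ S β
∈-S-ω⁻ {β} {x} x∈ =
  let x∈r , h = ∈-filter⁻ (T? ∘ _) {xs = range1 (sum β ∸ 1)} (subst (x ∈_) (S-ω β) x∈)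
      1≤x , x<N = range1-below (sum β) x∈r
  in 1≤x , x<N , λ x∈S → T-not⁻ h (elemᵇ⁺ (∈-S-reverse⁺ (<⇒≤ x<N) x∈S))

-- Weakly increasing words

nth1-zero : (d : A) (xs : List A) → nth1 d xs 0 ≡ d
nth1-zero d []      = refl
nth1-zero d (_ ∷ _) = refl

nth1-beyond : (d : A) (xs : List A) {j : ℕ} → length xs < j → nth1 d xs j ≡ d
nth1-beyond d []       _ = refl
nth1-beyond d (x ∷ xs) {suc (suc j)} (s≤s |xs|<j) = nth1-beyond d xs |xs|<j

nth1-ext : (d : A) {xs ys : List A} → length xs ≡ length ys →
  (∀ {j} → 1 ≤ j → j ≤ length xs → nth1 d xs j ≡ nth1 d ys j) → xs ≡ ys
nth1-ext d {[]}     {[]}     _  h = refl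
nth1-ext d {x ∷ xs} {y ∷ ys} eq h = cong₂ _∷_ (h (s≤s z≤n) (s≤s z≤n))
  (nth1-ext d (suc-injective eq) λ { {suc j} _ j≤ → h {suc (suc j)} (s≤s z≤n) (s≤s j≤) })

nth1-map : (f : A → B) (d : A) (xs : List A) (j : ℕ) → nth1 (f d) (map f xs) j ≡ f (nth1 d xs j)
nth1-map f d []       j             = refl
nth1-map f d (x ∷ xs) zero          = refl
nth1-map f d (x ∷ xs) (suc zero)    = refl
nth1-map f d (x ∷ xs) (suc (suc j)) = nth1-map f d xs (suc j)

nth1-∈ : (d : A) (xs : List A) {j : ℕ} → 1 ≤ j → j ≤ length xs → nth1 d xs j ∈ xs
nth1-∈ d (x ∷ xs) {suc zero}    _ _        = here refl
nth1-∈ d (x ∷ xs) {suc (suc j)} _ (s≤s j≤) = there (nth1-∈ d xs (s≤s z≤n) j≤)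

∈⇒nth1 : (d : A) {x : A} {xs : List A} → x ∈ xs → ∃ λ j → 1 ≤ j × j ≤ length xs × x ≡ nth1 d xs j
∈⇒nth1 d (here refl) = 1 , ≤-refl , s≤s z≤n , refl
∈⇒nth1 d (there x∈) with suc j , 1≤j , j≤ , eq ← ∈⇒nth1 d x∈ = suc (suc j) , s≤s z≤n , s≤s j≤ , eq

nth1-applyUpTo : (d : A) (f : ℕ → A) {N j : ℕ} → j < N → nth1 d (applyUpTo f N) (suc j) ≡ f j
nth1-applyUpTo d f {suc N} {zero}  _         = refl
nth1-applyUpTo d f {suc N} {suc j} (s≤s j<N) = nth1-applyUpTo d (f ∘ suc) j<N

nth1-map-range1 : (d : A) (f : ℕ → A) {N j : ℕ} → 1 ≤ j → j ≤ N → nth1 d (map f (range1 N)) j ≡ f j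
nth1-map-range1 d f {N} {suc j} _ j<N =
  trans (cong (λ xs → nth1 d xs (suc j)) (trans (sym (map-∘ (upTo N))) (map-upTo (f ∘ suc) N)))
    (nth1-applyUpTo d (f ∘ suc) j<N)

nth1-++ˡ : (d : A) (xs ys : List A) {j : ℕ} → 1 ≤ j → j ≤ length xs → nth1 d (xs ++ ys) j ≡ nth1 d xs j
nth1-++ˡ d (x ∷ xs) ys {suc zero}    _ _        = refl
nth1-++ˡ d (x ∷ xs) ys {suc (suc j)} _ (s≤s j≤) = nth1-++ˡ d xs ys (s≤s z≤n) j≤

nth1-++ʳ : (d : A) (xs ys : List A) {j : ℕ} → 1 ≤ j → nth1 d (xs ++ ys) (length xs + j) ≡ nth1 d ys j
nth1-++ʳ d []           ys _ = refl
nth1-++ʳ d (x ∷ [])     ys {suc j} _ = refl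
nth1-++ʳ d (x ∷ y ∷ xs) ys 1≤j = nth1-++ʳ d (y ∷ xs) ys 1≤j

-- On the empty word both give 0, which is also the value of `minM` and `maxM` on the empty
-- multiset, so the translation has no exceptions.
head₀ last₀ : List ℕ → ℕ
head₀ w = nth1 0 w 1
last₀ w = nth1 0 w (length w)

Sorted : List ℕ → Set
Sorted = AllPairs _≤_

head₀-least : ∀ {w x} → Sorted w → x ∈ w → head₀ w ≤ x
head₀-least (_ ∷ _)  (here refl) = ≤-refl
head₀-least (y≤ ∷ _) (there x∈)  = All.lookup y≤ x∈

last₀-greatest : ∀ {w x} → Sorted w → x ∈ w → x ≤ last₀ w
last₀-greatest {y ∷ []}     _            (here refl) = ≤-refl
last₀-greatest {y ∷ z ∷ w} ((y≤z ∷ _) ∷ s) (here refl) = ≤-trans y≤z (last₀-greatest s (here refl))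
last₀-greatest {y ∷ z ∷ w} (_ ∷ s)       (there x∈)  = last₀-greatest s x∈

Sorted⇒nth1-≤ : ∀ {w j} → Sorted w → 1 ≤ j → j < length w → nth1 0 w j ≤ nth1 0 w (suc j)
Sorted⇒nth1-≤ {y ∷ z ∷ w} {suc zero}    ((y≤z ∷ _) ∷ _) _ _         = y≤z
Sorted⇒nth1-≤ {y ∷ z ∷ w} {suc (suc j)} (_ ∷ s)         _ (s≤s j<w) = Sorted⇒nth1-≤ s (s≤s z≤n) j<w
Sorted⇒nth1-≤ {y ∷ []}    {suc j}       _               _ (s≤s ())

nth1-≤⇒Sorted : ∀ {w} → (∀ {j} → 1 ≤ j → j < length w → nth1 0 w j ≤ nth1 0 w (suc j)) → Sorted w
nth1-≤⇒Sorted {w} h = Linked⇒AllPairs ≤-trans (go w h)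
  where
  go : ∀ w → (∀ {j} → 1 ≤ j → j < length w → nth1 0 w j ≤ nth1 0 w (suc j)) → Linked _≤_ w
  go []          h = []
  go (y ∷ [])    h = [-]
  go (y ∷ z ∷ w) h = h (s≤s z≤n) (s≤s (s≤s z≤n)) ∷
    go (z ∷ w) λ { {suc j} _ j< → h {suc (suc j)} (s≤s z≤n) (s≤s j<) }

Sorted-++⁻ : ∀ xs {ys} → Sorted (xs ++ ys) → Sorted xs × Sorted ys
Sorted-++⁻ []       s        = [] , s
Sorted-++⁻ (x ∷ xs) (x≤ ∷ s) = let s₁ , s₂ = Sorted-++⁻ xs s in All.++⁻ˡ xs x≤ ∷ s₁ , s₂

Sorted-concat⁻ : ∀ P → Sorted (concat P) → All Sorted P
Sorted-concat⁻ []      _ = []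
Sorted-concat⁻ (X ∷ P) s = let s₁ , s₂ = Sorted-++⁻ X s in s₁ ∷ Sorted-concat⁻ P s₂

-- Since no piece is empty, the first letter of the remaining concatenation is the first letter of
-- the next piece, and comparing neighbours is enough.
Sorted-concat⁺ : ∀ {P} → All Sorted P → All ((1 ≤_) ∘ length) P →
  (∀ {j} → 1 ≤ j → j < length P → last₀ (nth1 [] P j) ≤ head₀ (nth1 [] P (suc j))) →
  Sorted (concat P)
Sorted-concat⁺ {[]}        _           _                  _ = []
Sorted-concat⁺ {X ∷ []}    (s ∷ [])    _                  _ = subst Sorted (sym (++-identityʳ X)) s
Sorted-concat⁺ {X ∷ Y ∷ P} (s ∷ ss)    (_ ∷ ne@(1≤Y ∷ _)) h =
  AllPairs.++⁺ s rest (All.tabulate λ x∈ → All.tabulate λ y∈ →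
    ≤-trans (last₀-greatest s x∈) (≤-trans (h (s≤s z≤n) (s≤s (s≤s z≤n)))
      (subst (_≤ _) (nth1-++ˡ 0 Y (concat P) (s≤s z≤n) 1≤Y) (head₀-least rest y∈))))
  where
  rest : Sorted (concat (Y ∷ P))
  rest = Sorted-concat⁺ ss ne λ { {suc j} _ j< → h {suc (suc j)} (s≤s z≤n) (s≤s j<) }

occ-++ : ∀ r v w → occ r (v ++ w) ≡ occ r v + occ r w
occ-++ r = count-++ (r ≡ᵇ_)

∈⇒occ>0 : ∀ {r w} → r ∈ w → 1 ≤ occ r w
∈⇒occ>0 {r} {x ∷ w} r∈ with r ≡ᵇ x in eq | r∈
... | true  | _          = s≤s z≤n
... | false | here refl  = ⊥-elim (subst T eq (≡⇒≡ᵇ r r refl))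
... | false | there r∈w  = ∈⇒occ>0 r∈w

occ>0⇒∈ : ∀ {r} w → 1 ≤ occ r w → r ∈ w
occ>0⇒∈ {r} (x ∷ w) h with r ≡ᵇ x in eq
... | true  = here (≡ᵇ⇒≡ r x (subst T (sym eq) _))
... | false = there (occ>0⇒∈ w h)

∉⇒occ≡0 : ∀ {r} w → r ∉ w → occ r w ≡ 0
∉⇒occ≡0 {r} w r∉ = n≮0⇒n≡0 (r∉ ∘ occ>0⇒∈ w)
  where
  n≮0⇒n≡0 : ∀ {k} → ¬ 1 ≤ k → k ≡ 0
  n≮0⇒n≡0 {zero}  _ = refl
  n≮0⇒n≡0 {suc k} h = ⊥-elim (h (s≤s z≤n))

occ-tail : ∀ {v w} x → (∀ r → occ r (x ∷ v) ≡ occ r (x ∷ w)) → ∀ r → occ r v ≡ occ r w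
occ-tail x h r with r ≡ᵇ x | h r
... | true  | eq = suc-injective eq
... | false | eq = eq

-- Each first letter occurs in the other word, so each is at most the other; cancel it and continue.
-- This is the uniqueness of W.
Sorted-unique : ∀ {v w} → Sorted v → Sorted w → (∀ r → occ r v ≡ occ r w) → v ≡ w
Sorted-unique {[]}    {[]}    _  _  _ = refl
Sorted-unique {[]}    {y ∷ w} _  _  h with () ← occ>0⇒∈ {y} [] (subst (1 ≤_) (sym (h y)) (∈⇒occ>0 {y} {w = y ∷ w} (here refl)))
Sorted-unique {x ∷ v} {[]}    _  _  h with () ← occ>0⇒∈ {x} [] (subst (1 ≤_) (h x) (∈⇒occ>0 {x} {w = x ∷ v} (here refl)))
Sorted-unique {x ∷ v} {y ∷ w} sv@(_ ∷ sv′) sw@(_ ∷ sw′) h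
  with refl ← ≤-antisym
    (head₀-least sv (occ>0⇒∈ (x ∷ v) (subst (1 ≤_) (sym (h y)) (∈⇒occ>0 {w = y ∷ w} (here refl)))))
    (head₀-least sw (occ>0⇒∈ (y ∷ w) (subst (1 ≤_) (h x) (∈⇒occ>0 {w = x ∷ v} (here refl)))))
  = cong (x ∷_) (Sorted-unique sv′ sw′ (occ-tail {v} {w} x h))

-- The multiset as a weakly increasing word, where the entries of the list are the multiplicities of
-- r, r + 1, and so on.
expand : ℕ → List ℕ → List ℕ
expand r []      = []
expand r (x ∷ b) = replicate x r ++ expand (suc r) b

expand-≥ : ∀ r b → All (r ≤_) (expand r b)
expand-≥ r []      = []
expand-≥ r (x ∷ b) = All.++⁺ (All.replicate⁺ x ≤-refl) (All.map <⇒≤ (expand-≥ (suc r) b))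

expand-< : ∀ r b → All (_< r + length b) (expand r b)
expand-< r []      = []
expand-< r (x ∷ b) = All.++⁺ (All.replicate⁺ x (m<m+n r (s≤s z≤n)))
  (subst (λ k → All (_< k) (expand (suc r) b)) (sym (+-suc r (length b))) (expand-< (suc r) b))

replicate-sorted : ∀ x r → Sorted (replicate x r)
replicate-sorted zero    r = []
replicate-sorted (suc x) r = All.replicate⁺ x ≤-refl ∷ replicate-sorted x r

expand-sorted : ∀ r b → Sorted (expand r b)
expand-sorted r []      = []
expand-sorted r (x ∷ b) = AllPairs.++⁺ (replicate-sorted x r) (expand-sorted (suc r) b)
  (All.replicate⁺ x (All.map <⇒≤ (expand-≥ (suc r) b)))

length-expand : ∀ r b → length (expand r b) ≡ sum b
length-expand r []      = refl
length-expand r (x ∷ b) = trans (length-++ (replicate x r))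
  (cong₂ _+_ (length-replicate x) (length-expand (suc r) b))

occ-replicate : ∀ x r → occ r (replicate x r) ≡ x
occ-replicate zero    r = refl
occ-replicate (suc x) r with r ≡ᵇ r in eq
... | true  = cong suc (occ-replicate x r)
... | false = ⊥-elim (subst T eq (≡⇒≡ᵇ r r refl))

occ-expand-< : ∀ {q} r b → q < r → occ q (expand r b) ≡ 0
occ-expand-< r b q<r = ∉⇒occ≡0 (expand r b) λ q∈ → <⇒≱ q<r (All.lookup (expand-≥ r b) q∈)

occ-expand-≥ : ∀ r b q → occ (r + q) (expand r b) ≡ nth1 0 b (suc q)
occ-expand-≥ r []      q = refl
occ-expand-≥ r (x ∷ b) q = trans (occ-++ (r + q) (replicate x r) (expand (suc r) b)) (go q)
  where
  go : ∀ q → occ (r + q) (replicate x r) + occ (r + q) (expand (suc r) b) ≡ nth1 0 (x ∷ b) (suc q)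
  -- The tail has only letters above r, so all occurrences of r lie in the first block.
  go zero rewrite +-identityʳ r | occ-replicate x r | occ-expand-< {r} (suc r) b ≤-refl = +-identityʳ x
  go (suc q)
    rewrite ∉⇒occ≡0 {r + suc q} (replicate x r)
              (λ r∈ → m≢1+m+n r (trans (sym (All.lookup {P = _≡ r} (All.replicate⁺ x refl) r∈)) (+-suc r q)))
          | +-suc r q = occ-expand-≥ (suc r) b q

occ-expand : ∀ b r → occ r (expand 1 b) ≡ nth1 0 b r
occ-expand b zero    = trans (occ-expand-< 1 b (s≤s z≤n)) (sym (nth1-zero 0 b))
occ-expand b (suc r) = occ-expand-≥ 1 b r

-- Trailing zeros leave no trace in the word, hence the condition on the lengths.
expand-injective : ∀ {b c} → length b ≡ length c → expand 1 b ≡ expand 1 c → b ≡ c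
expand-injective {b} {c} |b|≡|c| eq = nth1-ext 0 |b|≡|c| λ {j} _ _ →
  trans (sym (occ-expand b j)) (trans (cong (occ j) eq) (occ-expand c j))

nonemptyM⁻ : ∀ r b → T (nonemptyM b) → 1 ≤ length (expand r b)
nonemptyM⁻ r (zero  ∷ b) h = nonemptyM⁻ (suc r) b h
nonemptyM⁻ r (suc x ∷ b) h = s≤s z≤n

nonemptyM⁺ : ∀ r b → 1 ≤ length (expand r b) → T (nonemptyM b)
nonemptyM⁺ r (zero  ∷ b) h = nonemptyM⁺ (suc r) b h
nonemptyM⁺ r (suc x ∷ b) h = _

minFrom-expand : ∀ r b → minFrom r b ≡ head₀ (expand r b)
minFrom-expand r []          = refl
minFrom-expand r (zero  ∷ b) = minFrom-expand (suc r) b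
minFrom-expand r (suc x ∷ b) = refl

last₀-++ : ∀ v x w → last₀ (v ++ x ∷ w) ≡ last₀ (x ∷ w)
last₀-++ v x w = trans (cong (nth1 0 (v ++ x ∷ w)) (length-++ v)) (nth1-++ʳ 0 v (x ∷ w) (s≤s z≤n))

last₀-replicate : ∀ x r → last₀ (replicate (suc x) r) ≡ r
last₀-replicate zero    r = refl
last₀-replicate (suc x) r = last₀-replicate x r

-- Letters after the block of r all exceed r, so the maximum is the last of them if there are any;
-- otherwise `maxFrom` of the tail is 0 and r wins.
maxFrom-expand : ∀ r b → maxFrom r b ≡ last₀ (expand r b)
maxFrom-expand r []          = refl
maxFrom-expand r (zero  ∷ b) = maxFrom-expand (suc r) b
maxFrom-expand r (suc x ∷ b) rewrite maxFrom-expand (suc r) b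
  with expand (suc r) b | expand-≥ (suc r) b | expand-sorted (suc r) b
... | []    | _       | _ rewrite ++-identityʳ (replicate x r) =
  trans (⊔-identityʳ r) (sym (last₀-replicate x r))
... | y ∷ w | r<y ∷ _ | s =
  trans (m≤n⇒m⊔n≡n (≤-trans (<⇒≤ r<y) (last₀-greatest s (here refl))))
    (sym (last₀-++ (replicate (suc x) r) y w))

-- Inverse to `expand 1` on sorted words with letters in [k]; the fixed width k makes the inverse
-- unambiguous.
multiplicities : ℕ → List ℕ → List ℕ
multiplicities k w = map (λ r → occ r w) (range1 k)

length-range1 : ∀ N → length (range1 N) ≡ N
length-range1 N = trans (length-map suc (upTo N)) (length-upTo N)

length-multiplicities : ∀ k w → length (multiplicities k w) ≡ k
length-multiplicities k w = trans (length-map _ (range1 k)) (length-range1 k)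

nth1-multiplicities : ∀ k w r → All (_∈ range1 k) w → nth1 0 (multiplicities k w) r ≡ occ r w
nth1-multiplicities k w r w⊆ with 1 ≤? r | r ≤? k
... | yes 1≤r | yes r≤k = nth1-map-range1 0 (λ r → occ r w) 1≤r r≤k
... | no  1≰r | _ with refl ← n<1⇒n≡0 (≰⇒> 1≰r) =
  trans (nth1-zero 0 (multiplicities k w))
    (sym (∉⇒occ≡0 w λ r∈ → 1≰r (proj₁ (∈-range1⁻ (All.lookup w⊆ r∈)))))
... | yes _   | no r≰k =
  trans (nth1-beyond 0 (multiplicities k w) (subst (_< r) (sym (length-multiplicities k w)) (≰⇒> r≰k)))
    (sym (∉⇒occ≡0 w λ r∈ → r≰k (proj₂ (∈-range1⁻ (All.lookup w⊆ r∈)))))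

expand-multiplicities : ∀ {k w} → Sorted w → All (_∈ range1 k) w → expand 1 (multiplicities k w) ≡ w
expand-multiplicities {k} {w} s w⊆ = Sorted-unique (expand-sorted 1 (multiplicities k w)) s λ r →
  trans (occ-expand (multiplicities k w) r) (nth1-multiplicities k w r w⊆)

-- Cutting a word into nonempty pieces

Nonempty : List ℕ → Set
Nonempty w = 1 ≤ length w

-- Size of what follows the first j pieces. It is taken from the right because t(k), the size of the
-- last k parts, is then `rest (n ∸ k)`.
rest : ℕ → List (List ℕ) → ℕ
rest j P = length (concat (drop j P))

rest-length : ∀ P → rest (length P) P ≡ 0
rest-length []      = refl
rest-length (X ∷ P) = rest-length P

rest-suc-< : ∀ {P j} → All Nonempty P → j < length P → rest (suc j) P < rest j P
rest-suc-< {X ∷ P} {zero}  (1≤X ∷ _) _ =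
  subst (suc (length (concat P)) ≤_) (sym (length-++ X)) (+-monoˡ-≤ (length (concat P)) 1≤X)
rest-suc-< {X ∷ P} {suc j} (_ ∷ ne) (s≤s j<) = rest-suc-< ne j<

descending : ∀ {n} (u : ℕ → ℕ) → (∀ {j} → j < n → u (suc j) < u j) →
  ∀ {i j} → i < j → j ≤ n → u j < u i
descending {n} u step {i} {suc j} (s≤s i≤j) j<n with m≤n⇒m<n∨m≡n i≤j
... | inj₂ refl = step j<n
... | inj₁ i<j  = <-trans (step j<n) (descending u step i<j (<⇒≤ j<n))

rest-descending : ∀ {P i j} → All Nonempty P → i < j → j ≤ length P → rest j P < rest i P
rest-descending {P} ne = descending (λ j → rest j P) (rest-suc-< ne)

-- `q` is the place where the j-th piece ends. This turns a comparison of neighbouring parts into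
-- one of adjacent letters of W; nonemptiness ensures that these two letters belong to pieces j and
-- j + 1.
nth1-concat-rest : ∀ {P j} → All Nonempty P → 1 ≤ j → j < length P →
  let q = length (concat P) ∸ rest j P in
  nth1 0 (concat P) q ≡ last₀ (nth1 [] P j) ×
  nth1 0 (concat P) (suc q) ≡ head₀ (nth1 [] P (suc j))
nth1-concat-rest {X ∷ []}    {suc j} _ _ (s≤s ())
nth1-concat-rest {X ∷ Y ∷ P} {suc zero} (1≤X ∷ 1≤Y ∷ _) _ _
  rewrite length-++ X {Y ++ concat P} | m+n∸n≡m (length X) (length (Y ++ concat P)) =
  nth1-++ˡ 0 X (Y ++ concat P) 1≤X ≤-refl ,
  trans (cong (nth1 0 (X ++ Y ++ concat P)) (+-comm 1 (length X)))
    (trans (nth1-++ʳ 0 X (Y ++ concat P) ≤-refl) (nth1-++ˡ 0 Y (concat P) ≤-refl 1≤Y))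
-- Prepending `X` shifts the cut by `length X` and leaves the sizes to its right unchanged; `1≤q`
-- keeps the place within the tail.
nth1-concat-rest {X ∷ P@(_ ∷ _)} {suc (suc j)} (_ ∷ ne) _ (s≤s j<) =
  let last , head = nth1-concat-rest {P} ne (s≤s z≤n) j< in
  trans (cong (nth1 0 (concat (X ∷ P))) shift) (trans (nth1-++ʳ 0 X (concat P) 1≤q) last) ,
  trans (cong (nth1 0 (concat (X ∷ P))) (trans (cong suc shift) (sym (+-suc (length X) q))))
    (trans (nth1-++ʳ 0 X (concat P) (s≤s z≤n)) head)
  where
  q = length (concat P) ∸ rest (suc j) P
  r<P : rest (suc j) P < length (concat P)
  r<P = rest-descending ne (s≤s z≤n) (<⇒≤ j<)
  1≤q : 1 ≤ q
  1≤q = m<n⇒0<n∸m r<P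
  shift : length (concat (X ∷ P)) ∸ rest (suc j) P ≡ length X + q
  shift = trans (cong (_∸ rest (suc j) P) (length-++ X)) (+-∸-assoc (length X) (<⇒≤ r<P))

++-injective : {v w xs ys : List A} → length v ≡ length w → v ++ xs ≡ w ++ ys → v ≡ w × xs ≡ ys
++-injective {v = []}    {[]}    _  eq = refl , eq
++-injective {v = x ∷ v} {y ∷ w} le eq with refl , eq′ ← ∷-injective eq
  with refl , eq″ ← ++-injective {v = v} {w} (suc-injective le) eq′ = refl , eq″

-- Differences of consecutive suffix sizes are the lengths of the pieces, so the two words are cut
-- at the same places.
concat-injective : ∀ {P Q} → length P ≡ length Q → concat P ≡ concat Q →
  (∀ {j} → 1 ≤ j → j < length P → rest j P ≡ rest j Q) → P ≡ Q
concat-injective {[]}    {[]}    _  _  _ = refl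
concat-injective {X ∷ P} {Y ∷ Q} le eq h =
  let X≡Y , P≡Q = ++-injective |X|≡|Y| eq in
  cong₂ _∷_ X≡Y (concat-injective (suc-injective le) P≡Q
    λ { {suc j} _ j< → h {suc (suc j)} (s≤s z≤n) (s≤s j<) })
  where
  -- The hypothesis at index 1 is available only if a second piece exists; if none does, both tails
  -- are empty.
  tails′ : ∀ P Q → length P ≡ length Q → (1 ≤ length P → rest 0 P ≡ rest 0 Q) → rest 0 P ≡ rest 0 Q
  tails′ []      []      _ _ = refl
  tails′ (_ ∷ _) (_ ∷ _) _ h = h (s≤s z≤n)
  tails : rest 0 P ≡ rest 0 Q
  tails = tails′ P Q (suc-injective le) λ 1≤P → h (s≤s z≤n) (s≤s 1≤P)
  |X|≡|Y| : length X ≡ length Y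
  |X|≡|Y| = +-cancelʳ-≡ (length (concat P)) (length X) (length Y)
    (trans (sym (length-++ X)) (trans (cong length eq)
      (trans (length-++ Y) (cong (length Y +_) (sym tails)))))

-- `u` prescribes the suffix sizes. Its fall from `length w` to 0 exhausts the word, and strictness
-- makes every piece nonempty.
split : ∀ n (u : ℕ → ℕ) w → u 0 ≡ length w → u n ≡ 0 → (∀ {j} → j < n → u (suc j) < u j) →
  ∃ λ P → length P ≡ n × concat P ≡ w × All Nonempty P × (∀ {j} → j ≤ n → rest j P ≡ u j)
split zero u w u0 un _ with w | trans (sym u0) un
... | [] | _ = [] , refl , refl , [] , λ { z≤n → sym un }
split (suc n) u w u0 un step =
  let P , |P| , cP , ne , rests = split n (u ∘ suc) Y (sym |Y|) un (step ∘ s≤s)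
      cXP = trans (cong (X ++_) cP) (take++drop≡id d w)
  in X ∷ P , cong suc |P| , cXP , 1≤X ∷ ne ,
     λ { {zero} _ → trans (cong length cXP) (sym u0) ; {suc j} (s≤s j≤n) → rests j≤n }
  where
  -- The first piece is what a suffix of size `u 1` leaves over.
  d = length w ∸ u 1
  X = take d w
  Y = drop d w
  u1<w : u 1 < length w
  u1<w = subst (u 1 <_) u0 (step (s≤s z≤n))
  |Y| : length Y ≡ u 1
  |Y| = trans (length-drop d w) (m∸[m∸n]≡n (<⇒≤ u1<w))
  1≤X : Nonempty X
  1≤X = +-cancelʳ-< (length Y) 0 (length X) (subst₂ _<_ (sym |Y|)
    (trans (sym (cong length (take++drop≡id d w))) (length-++ X)) u1<w)

-- Multiset-valued partitions as sequences of words

pieces : List (List ℕ) → List (List ℕ)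
pieces = map (expand 1)

occ-pieces : ∀ r σ → occ r (concat (pieces σ)) ≡ sum (map (λ b → nth1 0 b r) σ)
occ-pieces r []      = refl
occ-pieces r (b ∷ σ) = trans (occ-++ r (expand 1 b) _) (cong₂ _+_ (occ-expand b r) (occ-pieces r σ))

-- Definitionally the comparison made in both `coeffL` and `coeffLhat`, so that one can be traded
-- for the other.
stepᵇ : Bool → ℕ → ℕ → Bool
stepᵇ b x y = if b then x <ᵇ y else x ≤ᵇ y

stepᵇ⇒≤ : ∀ b {x y} → T (stepᵇ b x y) → x ≤ y
stepᵇ⇒≤ true  {x} {y} h = <⇒≤ (<ᵇ⇒< x y h)
stepᵇ⇒≤ false {x} {y} h = ≤ᵇ⇒≤ x y h

≤⇒stepᵇ : ∀ b {x y} → ¬ T b → x ≤ y → T (stepᵇ b x y)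
≤⇒stepᵇ true  ¬b _   = ⊥-elim (¬b _)
≤⇒stepᵇ false _  x≤y = ≤⇒≤ᵇ x≤y

-- Strict implies weak, so a test may be replaced by one that is strict in fewer cases.
stepᵇ-mono : ∀ b c {x y} → (T b → T c) → T (stepᵇ c x y) → T (stepᵇ b x y)
stepᵇ-mono true  true  f h = h
stepᵇ-mono true  false f h = ⊥-elim (f _)
stepᵇ-mono false c {x} {y} f h = ≤⇒≤ᵇ (stepᵇ⇒≤ c {x} {y} h)

Pointwise-nth1 : ∀ {a b} → length b ≡ length a → (∀ r → nth1 0 b r ≤ nth1 0 a r) → Pointwise _≤_ b a
Pointwise-nth1 {[]}    {[]}    _  h = []
Pointwise-nth1 {x ∷ a} {y ∷ b} le h = h 1 ∷ Pointwise-nth1 (suc-injective le)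
  λ { zero → ≤-reflexive (trans (nth1-zero 0 b) (sym (nth1-zero 0 a))) ; (suc r) → h (suc (suc r)) }

sum-map-zero : (f : A → ℕ) {xs : List A} → All (λ x → f x ≡ 0) xs → sum (map f xs) ≡ 0
sum-map-zero f []        = refl
sum-map-zero f (eq ∷ eqs) = cong₂ _+_ eq (sum-map-zero f eqs)

∈⇒≤sum-map : (f : A → ℕ) {x : A} {xs : List A} → x ∈ xs → f x ≤ sum (map f xs)
∈⇒≤sum-map f {xs = y ∷ xs} (here refl) = m≤m+n (f y) _
∈⇒≤sum-map f {xs = y ∷ xs} (there x∈)  = ≤-trans (∈⇒≤sum-map f x∈) (m≤n+m _ (f y))

-- The multiplicity tests cover only the letters of [k]; the second case is where both sides are 0
-- for reasons of range.
∈-range1? : ∀ k r → r ∈ range1 k ⊎ (r ≡ 0 ⊎ k < r)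
∈-range1? k zero = inj₂ (inj₁ refl)
∈-range1? k r@(suc _) with r ≤? k
... | yes r≤k = inj₁ (∈-range1⁺ (s≤s z≤n) r≤k)
... | no  r≰k = inj₂ (inj₂ (≰⇒> r≰k))

nth1-outside : ∀ b {r} → r ≡ 0 ⊎ length b < r → nth1 0 b r ≡ 0
nth1-outside b (inj₁ refl) = nth1-zero 0 b
nth1-outside b (inj₂ |b|<r) = nth1-beyond 0 b |b|<r

expand⊆range1 : ∀ b → All (_∈ range1 (length b)) (expand 1 b)
expand⊆range1 b = All.zipWith (λ (1≤x , x<) → ∈-range1⁺ 1≤x (s≤s⁻¹ x<)) (expand-≥ 1 b , expand-< 1 b)

-- okσ, okw and okt are definitionally the local predicates ok of coeffLhat, coeffL and
-- Tcount; n, s, m and D are kept abstract where those have sum α, membership in S α, sum γ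
-- and S (ω α).
module _ (n : ℕ) (s : ℕ → Bool) (a : List ℕ) where

  private
    separatedᵇ : List (List ℕ) → Bool
    separatedᵇ σ = allB (λ j → stepᵇ (s j) (maxM (nth1 [] σ j)) (minM (nth1 [] σ (suc j)))) (range1 (n ∸ 1))

  okσ : List (List ℕ) → Bool
  okσ σ = allB nonemptyM σ
    ∧ separatedᵇ σ
    ∧ allB (λ r → sum (map (λ b → nth1 0 b r) σ) ≡ᵇ nth1 0 a r) (range1 (length a))

  -- The conditions on σ in terms of words. `content` absorbs the multiplicities and the bounds from
  -- `boxes`; `widths` keeps what `expand` forgets.
  record Valid (σ : List (List ℕ)) : Set where
    field
      size     : length σ ≡ n
      widths   : All (λ b → length b ≡ length a) σ
      nonempty : All Nonempty (pieces σ)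
      boundary : ∀ {j} → 1 ≤ j → j ≤ n ∸ 1 →
        T (stepᵇ (s j) (last₀ (nth1 [] (pieces σ) j)) (head₀ (nth1 [] (pieces σ) (suc j))))
      content  : concat (pieces σ) ≡ expand 1 a

  private
    max-piece : ∀ σ j → maxM (nth1 [] σ j) ≡ last₀ (nth1 [] (pieces σ) j)
    max-piece σ j = trans (maxFrom-expand 1 (nth1 [] σ j)) (cong last₀ (sym (nth1-map (expand 1) [] σ j)))

    min-piece : ∀ σ j → minM (nth1 [] σ j) ≡ head₀ (nth1 [] (pieces σ) j)
    min-piece σ j = trans (minFrom-expand 1 (nth1 [] σ j)) (cong head₀ (sym (nth1-map (expand 1) [] σ j)))

    boundary-eq : ∀ σ j → stepᵇ (s j) (maxM (nth1 [] σ j)) (minM (nth1 [] σ (suc j))) ≡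
      stepᵇ (s j) (last₀ (nth1 [] (pieces σ) j)) (head₀ (nth1 [] (pieces σ) (suc j)))
    boundary-eq σ j = cong₂ (stepᵇ (s j)) (max-piece σ j) (min-piece σ (suc j))

  okσ⇒Valid : ∀ {σ} → σ ∈ words n (boxes a) → T (okσ σ) → Valid σ
  okσ⇒Valid {σ} σ∈ ok = record
    { size = size ; widths = widths ; nonempty = ne ; boundary = boundary ; content = content }
    where
    size = proj₁ (∈-words⁻ n σ∈)
    widths : All (λ b → length b ≡ length a) σ
    widths = All.map (Pointwise-length ∘ ∈-boxes⁻ {a}) (proj₂ (∈-words⁻ n σ∈))
    ok₁ = proj₁ (to T-∧ ok)
    ok₂₃ = to (T-∧ {separatedᵇ σ}) (proj₂ (to (T-∧ {allB nonemptyM σ}) ok))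
    ne : All Nonempty (pieces σ)
    ne = All.map⁺ (All.tabulate λ {b} b∈ → nonemptyM⁻ 1 b (allB⁻ σ ok₁ b∈))
    boundary : ∀ {j} → 1 ≤ j → j ≤ n ∸ 1 →
        T (stepᵇ (s j) (last₀ (nth1 [] (pieces σ) j)) (head₀ (nth1 [] (pieces σ) (suc j))))
    boundary {j} 1≤j j≤ = subst T (boundary-eq σ j) (allB⁻ (range1 (n ∸ 1)) (proj₁ ok₂₃) (∈-range1⁺ 1≤j j≤))
    -- Strict or not, every boundary test yields at least a weak inequality.
    sorted : Sorted (concat (pieces σ))
    sorted = Sorted-concat⁺ (All.map⁺ (All.tabulate λ {b} _ → expand-sorted 1 b)) ne
      λ {j} 1≤j j< → stepᵇ⇒≤ (s j)
        (boundary 1≤j (<⇒≤pred (subst (j <_) (trans (length-map (expand 1) σ) size) j<)))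
    multiplicity : ∀ r → sum (map (λ b → nth1 0 b r) σ) ≡ nth1 0 a r
    multiplicity r with ∈-range1? (length a) r
    ... | inj₁ r∈ = ≡ᵇ⇒≡ _ _ (allB⁻ (range1 (length a)) (proj₂ ok₂₃) r∈)
    ... | inj₂ r∉ = trans
      (sum-map-zero (λ b → nth1 0 b r) (All.map (λ {b} |b| →
        nth1-outside b (subst (λ k → r ≡ 0 ⊎ k < r) (sym |b|) r∉)) widths))
      (sym (nth1-outside a r∉))
    content : concat (pieces σ) ≡ expand 1 a
    content = Sorted-unique sorted (expand-sorted 1 a) λ r →
      trans (occ-pieces r σ) (trans (multiplicity r) (sym (occ-expand a r)))

  Valid⇒okσ : ∀ {σ} → Valid σ → σ ∈ words n (boxes a) × T (okσ σ)
  Valid⇒okσ {σ} v = subst (λ k → σ ∈ words k (boxes a)) size (∈-words⁺ (All.tabulate λ {b} b∈ →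
      -- A multiplicity in one part is a summand of the total, whence its bound by the entry of `a`.
      ∈-boxes⁺ (Pointwise-nth1 {a} (All.lookup widths b∈) λ r →
        subst (nth1 0 b r ≤_) (multiplicity r) (∈⇒≤sum-map (λ b → nth1 0 b r) b∈)))) ,
    from T-∧ (allB⁺ σ (λ {b} b∈ → nonemptyM⁺ 1 b (All.lookup (All.map⁻ nonempty) b∈)) ,
    from T-∧ (allB⁺ (range1 (n ∸ 1)) (λ {j} j∈ → let 1≤j , j≤ = ∈-range1⁻ j∈ in
                subst T (sym (boundary-eq σ j)) (boundary 1≤j j≤)) ,
              allB⁺ (range1 (length a)) λ {r} _ → ≡⇒≡ᵇ _ _ (multiplicity r)))
    where
    open Valid v
    multiplicity : ∀ r → sum (map (λ b → nth1 0 b r) σ) ≡ nth1 0 a r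
    multiplicity r = trans (sym (occ-pieces r σ)) (trans (cong (occ r) content) (occ-expand a r))

module _ (m : ℕ) (γ a : List ℕ) where

  private
    ascendsᵇ : List ℕ → Bool
    ascendsᵇ w = allB (λ j → stepᵇ (elemᵇ j (S γ)) (nth1 0 w j) (nth1 0 w (suc j))) (range1 (m ∸ 1))

  okw : List ℕ → Bool
  okw w = ascendsᵇ w
    ∧ allB (λ r → occ r w ≡ᵇ nth1 0 a r) (range1 (length a))

  okw⇒step : ∀ {w j} → T (okw w) → 1 ≤ j → j ≤ m ∸ 1 →
    T (stepᵇ (elemᵇ j (S γ)) (nth1 0 w j) (nth1 0 w (suc j)))
  okw⇒step ok 1≤j j≤ = allB⁻ (range1 (m ∸ 1)) (proj₁ (to T-∧ ok)) (∈-range1⁺ 1≤j j≤)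

  -- All tests give weak inequalities, so w is sorted, and a sorted word is determined by its
  -- content. Thus each `coeffL` counts at most the one word W.
  okw⇒≡expand : ∀ {w} → w ∈ words m (range1 (length a)) → T (okw w) → w ≡ expand 1 a
  okw⇒≡expand {w} w∈ ok = Sorted-unique
    (nth1-≤⇒Sorted λ {j} 1≤j j<w → stepᵇ⇒≤ (elemᵇ j (S γ))
      (okw⇒step {w} ok 1≤j (<⇒≤pred (subst (j <_) |w| j<w))))
    (expand-sorted 1 a)
    λ r → trans (multiplicity r) (sym (occ-expand a r))
    where
    |w| = proj₁ (∈-words⁻ m w∈)
    w⊆  = proj₂ (∈-words⁻ m w∈)
    multiplicity : ∀ r → occ r w ≡ nth1 0 a r
    multiplicity r with ∈-range1? (length a) r
    ... | inj₁ r∈ = ≡ᵇ⇒≡ _ _ (allB⁻ (range1 (length a)) (proj₂ (to (T-∧ {ascendsᵇ w}) ok)) r∈)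
    ... | inj₂ r∉ = trans (∉⇒occ≡0 w (λ r∈ → outside r∉ (∈-range1⁻ (All.lookup w⊆ r∈))))
                      (sym (nth1-outside a r∉))
      where
      outside : ∀ {k r} → r ≡ 0 ⊎ k < r → ¬ (1 ≤ r × r ≤ k)
      outside (inj₁ refl) (() , _)
      outside (inj₂ k<r)  (_ , r≤k) = <⇒≱ k<r r≤k

  okw-expand : (∀ {j} → 1 ≤ j → j ≤ m ∸ 1 →
    T (stepᵇ (elemᵇ j (S γ)) (nth1 0 (expand 1 a) j) (nth1 0 (expand 1 a) (suc j)))) → T (okw (expand 1 a))
  okw-expand step = from T-∧
    (allB⁺ (range1 (m ∸ 1)) (λ j∈ → let 1≤j , j≤ = ∈-range1⁻ j∈ in step 1≤j j≤) ,
     allB⁺ (range1 (length a)) λ {r} _ → ≡⇒≡ᵇ _ _ (occ-expand a r))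

-- For γ = ω(𝒞(E)) the sum equals m only by a proof, whereas `coeffL` computes with the sum itself.
coeffL-count : ∀ {m} γ a → sum γ ≡ m → coeffL γ a ≡ count (okw m γ a) (words m (range1 (length a)))
coeffL-count γ a refl = refl

T-if⁺ : ∀ {b c} → (T b → T c) → T (if b then c else true)
T-if⁺ {true}  f = f _
T-if⁺ {false} f = _

T-if⁻ : ∀ {b c} → T (if b then c else true) → T b → T c
T-if⁻ {true} h _ = h

-- The maps t and the sets E they determine

module _ (n′ M : ℕ) (s : ℕ → Bool) where

  record Embedding (t : List ℕ) : Set where
    field
      size     : length t ≡ n′
      bounds   : ∀ {k} → 1 ≤ k → k ≤ n′ → 1 ≤ nth1 0 t k × nth1 0 t k ≤ M
      monotone : ∀ {k k′} → 1 ≤ k → k < k′ → k′ ≤ n′ → nth1 0 t k < nth1 0 t k′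

    injective : ∀ {k k′} → 1 ≤ k → k ≤ n′ → 1 ≤ k′ → k′ ≤ n′ → nth1 0 t k ≡ nth1 0 t k′ → k ≡ k′
    injective {k} {k′} 1≤k k≤ 1≤k′ k′≤ eq with <-cmp k k′
    ... | tri≈ _ k≡k′ _ = k≡k′
    ... | tri< k<k′ _ _ = ⊥-elim (<-irrefl eq (monotone 1≤k k<k′ k′≤))
    ... | tri> _ _ k′<k = ⊥-elim (<-irrefl (sym eq) (monotone 1≤k′ k′<k k≤))

  -- The complement of E in [M] is the image under t of the complement of D; that k is outside D is
  -- expressed as `s` holding at n - k.
  record Fits (t E : List ℕ) : Set where
    field
      subset  : E ∈ powerset (range1 M)
      avoids  : ∀ {k} → 1 ≤ k → k ≤ n′ → T (s (suc n′ ∸ k)) → nth1 0 t k ∉ E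
      missing : ∀ {x} → 1 ≤ x → x ≤ M → x ∉ E →
        ∃ λ k → 1 ≤ k × k ≤ n′ × x ≡ nth1 0 t k × T (s (suc n′ ∸ k))

  Fits-unique : ∀ {t E E′} → Fits t E → Fits t E′ → E ≡ E′
  Fits-unique {t} {E} {E′} f f′ = trans (∈-powerset⇒filterᵇ (range1-unique M) (Fits.subset f))
    (trans (filterᵇ-cong (range1 M) λ x∈ → T-injective (⊆ f f′ x∈) (⊆ f′ f x∈))
      (sym (∈-powerset⇒filterᵇ (range1-unique M) (Fits.subset f′))))
    where
    ⊆ : ∀ {E E′ x} → Fits t E → Fits t E′ → x ∈ range1 M → T (elemᵇ x E) → T (elemᵇ x E′)
    ⊆ {E} {E′} {x} f f′ x∈ h with T? (elemᵇ x E′)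
    ... | yes x∈E′ = x∈E′
    ... | no  x∉E′ =
      let 1≤x , x≤M = ∈-range1⁻ x∈
          k , 1≤k , k≤ , x≡ , sk = Fits.missing f′ 1≤x x≤M (x∉E′ ∘ elemᵇ⁺)
      in ⊥-elim (Fits.avoids f 1≤k k≤ sk (subst (_∈ E) x≡ (elemᵇ⁻ E h)))

  excluded : List ℕ → List ℕ
  excluded t = map (nth1 0 t) (filterᵇ (λ k → s (suc n′ ∸ k)) (range1 n′))

  fitting : List ℕ → List ℕ
  fitting t = filterᵇ (λ x → not (elemᵇ x (excluded t))) (range1 M)

  fitting-Fits : ∀ t → Fits t (fitting t)
  fitting-Fits t = record { subset = filterᵇ∈powerset _ (range1 M) ; avoids = avoids ; missing = missing }
    where
    sᵏ = λ k → s (suc n′ ∸ k)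
    avoids : ∀ {k} → 1 ≤ k → k ≤ n′ → T (s (suc n′ ∸ k)) → nth1 0 t k ∉ fitting t
    avoids {k} 1≤k k≤ sk tk∈ = T-not⁻ (proj₂ (∈-filter⁻ (T? ∘ _) {xs = range1 M} tk∈))
      (elemᵇ⁺ (∈-map⁺ (nth1 0 t) (∈-filter⁺ (T? ∘ sᵏ) (∈-range1⁺ 1≤k k≤) sk)))
    missing : ∀ {x} → 1 ≤ x → x ≤ M → x ∉ fitting t →
        ∃ λ k → 1 ≤ k × k ≤ n′ × x ≡ nth1 0 t k × T (s (suc n′ ∸ k))
    missing {x} 1≤x x≤M x∉ with T? (elemᵇ x (excluded t))
    ... | no  ¬exc = ⊥-elim (x∉ (∈-filter⁺ (T? ∘ _) (∈-range1⁺ 1≤x x≤M) (T-not⁺ ¬exc)))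
    ... | yes exc =
      let k , k∈ , x≡ = ∈-map⁻ (nth1 0 t) (elemᵇ⁻ {x} (excluded t) exc)
          k∈r , sk = ∈-filter⁻ (T? ∘ sᵏ) {xs = range1 n′} k∈
          1≤k , k≤ = ∈-range1⁻ k∈r
      in k , 1≤k , k≤ , x≡ , sk

module _ (n′ M : ℕ) (s : ℕ → Bool) (D : List ℕ)
  (D⁺ : ∀ {k} → 1 ≤ k → k ≤ n′ → ¬ T (s (suc n′ ∸ k)) → k ∈ D)
  (D⁻ : ∀ {k} → k ∈ D → 1 ≤ k × k ≤ n′ × ¬ T (s (suc n′ ∸ k))) where

  private
    Emb = Embedding n′ M s
    Fit = Fits n′ M s

  okt : List ℕ → List ℕ → Bool
  okt E t =
      allB (λ j → allB (λ j′ → if t′ j ≡ᵇ t′ j′ then j ≡ᵇ j′ else true) (range1 n′)) (range1 n′)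
    ∧ allB (λ j → allB (λ j′ → if j <ᵇ j′ then t′ j ≤ᵇ t′ j′ else true) (range1 n′)) (range1 n′)
    ∧ allB (λ d → elemᵇ (t′ d) E) D
    ∧ allB (λ x → iffᵇ (elemᵇ x E ∧ not (elemᵇ x (map t′ D))) (not (elemᵇ x (map t′ (range1 n′)))))
           (range1 M)
    where
    t′ : ℕ → ℕ
    t′ = nth1 0 t

  -- If k is outside D, then t(k) is outside t(D) by injectivity, so membership of t(k) in E would
  -- put it outside the image of t. If x is not in E, it cannot lie outside the image, as those
  -- points belong to E, nor in t(D); so x = t(k) with k outside D.
  okt⇒ : ∀ {t E} → t ∈ words n′ (range1 M) → E ∈ powerset (range1 M) → T (okt E t) →
    Emb t × Fit t E
  okt⇒ {t} {E} t∈ E∈ ok =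
    record { size = size ; bounds = bounds ; monotone = monotone } ,
    record { subset = E∈ ; avoids = avoids ; missing = missing }
    where
    t′ = nth1 0 t
    dom = range1 n′
    ok₁ : ∀ {j j′} → j ∈ dom → j′ ∈ dom → T (if t′ j ≡ᵇ t′ j′ then j ≡ᵇ j′ else true)
    ok₁ j∈ = allB⁻ dom (allB⁻ dom (proj₁ (to T-∧ ok)) j∈)
    ok₂₋₄ = proj₂ (to (T-∧ {allB (λ j → allB (λ j′ → if t′ j ≡ᵇ t′ j′ then j ≡ᵇ j′ else true) dom) dom}) ok)
    ok₂ : ∀ {j j′} → j ∈ dom → j′ ∈ dom → T (if j <ᵇ j′ then t′ j ≤ᵇ t′ j′ else true)
    ok₂ j∈ = allB⁻ dom (allB⁻ dom (proj₁ (to T-∧ ok₂₋₄)) j∈)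
    ok₃₋₄ = proj₂ (to (T-∧ {allB (λ j → allB (λ j′ → if j <ᵇ j′ then t′ j ≤ᵇ t′ j′ else true) dom) dom}) ok₂₋₄)
    ok₃ : ∀ {d} → d ∈ D → t′ d ∈ E
    ok₃ d∈ = elemᵇ⁻ E (allB⁻ D (proj₁ (to T-∧ ok₃₋₄)) d∈)
    ok₄ : ∀ {x} → x ∈ range1 M →
      (T (elemᵇ x E ∧ not (elemᵇ x (map t′ D))) → T (not (elemᵇ x (map t′ dom)))) ×
      (T (not (elemᵇ x (map t′ dom))) → T (elemᵇ x E ∧ not (elemᵇ x (map t′ D))))
    ok₄ x∈ = T-iffᵇ⁻ (allB⁻ (range1 M) (proj₂ (to (T-∧ {allB (λ d → elemᵇ (t′ d) E) D}) ok₃₋₄)) x∈)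
    size = proj₁ (∈-words⁻ n′ t∈)
    inject : ∀ {j j′} → j ∈ dom → j′ ∈ dom → t′ j ≡ t′ j′ → j ≡ j′
    inject {j} {j′} j∈ j′∈ eq = ≡ᵇ⇒≡ j j′ (T-if⁻ (ok₁ j∈ j′∈) (≡⇒≡ᵇ (t′ j) (t′ j′) eq))
    bounds : ∀ {k} → 1 ≤ k → k ≤ n′ → 1 ≤ t′ k × t′ k ≤ M
    bounds {k} 1≤k k≤ = ∈-range1⁻ (All.lookup (proj₂ (∈-words⁻ n′ t∈))
      (nth1-∈ 0 t 1≤k (subst (k ≤_) (sym size) k≤)))
    monotone : ∀ {k k′} → 1 ≤ k → k < k′ → k′ ≤ n′ → t′ k < t′ k′
    monotone {k} {k′} 1≤k k<k′ k′≤ = ≤∧≢⇒<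
      (≤ᵇ⇒≤ (t′ k) (t′ k′) (T-if⁻ (ok₂ k∈ k′∈) (<⇒<ᵇ k<k′)))
      (λ eq → <-irrefl (inject k∈ k′∈ eq) k<k′)
      where
      k∈  = ∈-range1⁺ 1≤k (≤-trans (<⇒≤ k<k′) k′≤)
      k′∈ = ∈-range1⁺ (≤-trans 1≤k (<⇒≤ k<k′)) k′≤
    avoids : ∀ {k} → 1 ≤ k → k ≤ n′ → T (s (suc n′ ∸ k)) → t′ k ∉ E
    avoids {k} 1≤k k≤ sk tk∈ = T-not⁻
      (proj₁ (ok₄ (∈-powerset⇒⊆ (range1 M) E∈ tk∈)) (from T-∧ (elemᵇ⁺ tk∈ , T-not⁺ tk∉tD)))
      (elemᵇ⁺ (∈-map⁺ t′ (∈-range1⁺ 1≤k k≤)))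
      where
      tk∉tD : ¬ T (elemᵇ (t′ k) (map t′ D))
      tk∉tD h =
        let d , d∈ , eq = ∈-map⁻ t′ (elemᵇ⁻ {t′ k} (map t′ D) h)
            1≤d , d≤ , ¬sd = D⁻ d∈
        in ¬sd (subst (λ k → T (s (suc n′ ∸ k))) (inject (∈-range1⁺ 1≤k k≤) (∈-range1⁺ 1≤d d≤) eq) sk)
    missing : ∀ {x} → 1 ≤ x → x ≤ M → x ∉ E →
      ∃ λ k → 1 ≤ k × k ≤ n′ × x ≡ t′ k × T (s (suc n′ ∸ k))
    missing {x} 1≤x x≤M x∉ with T? (elemᵇ x (map t′ dom))
    ... | no  x∉t = ⊥-elim (x∉ (elemᵇ⁻ E (proj₁ (to T-∧ (proj₂ (ok₄ (∈-range1⁺ 1≤x x≤M)) (T-not⁺ x∉t))))))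
    ... | yes x∈t with k , k∈ , refl ← ∈-map⁻ t′ (elemᵇ⁻ {x} (map t′ dom) x∈t) with T? (s (suc n′ ∸ k)) | ∈-range1⁻ k∈
    ...   | yes sk | 1≤k , k≤ = k , 1≤k , k≤ , refl , sk
    ...   | no ¬sk | 1≤k , k≤ = ⊥-elim (x∉ (ok₃ (D⁺ 1≤k k≤ ¬sk)))

  -- A point of [M] not in E is some t(k) with k outside D. By injectivity it is not in t(D), so
  -- t(D) lies in E, and points outside the image lie in E as well.
  okt⇐ : ∀ {t E} → Emb t → Fit t E → t ∈ words n′ (range1 M) × T (okt E t)
  okt⇐ {t} {E} emb fits =
    subst (λ k → t ∈ words k (range1 M)) size (∈-words⁺ (All.tabulate t⊆)) ,
    from T-∧ (allB⁺ dom (λ {j} j∈ → allB⁺ dom λ {j′} j′∈ → T-if⁺ λ eq →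
                ≡⇒≡ᵇ j j′ (inject j∈ j′∈ (≡ᵇ⇒≡ (t′ j) (t′ j′) eq))) ,
    from T-∧ (allB⁺ dom (λ {j} j∈ → allB⁺ dom λ {j′} j′∈ → T-if⁺ λ j<j′ →
                ≤⇒≤ᵇ (<⇒≤ (monotone (proj₁ (∈-range1⁻ j∈)) (<ᵇ⇒< j j′ j<j′) (proj₂ (∈-range1⁻ j′∈))))) ,
    from T-∧ (allB⁺ D tD⊆E ,
              allB⁺ (range1 M) λ {x} x∈ → T-iffᵇ⁺ (forward x) (backward x∈))))
    where
    open Embedding emb
    open Fits fits
    t′ = nth1 0 t
    dom = range1 n′
    t⊆ : ∀ {x} → x ∈ t → x ∈ range1 M
    t⊆ {x} x∈ with k , 1≤k , k≤ , refl ← ∈⇒nth1 0 x∈ =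
      let 1≤tk , tk≤ = bounds 1≤k (subst (k ≤_) size k≤) in ∈-range1⁺ 1≤tk tk≤
    inject : ∀ {j j′} → j ∈ dom → j′ ∈ dom → t′ j ≡ t′ j′ → j ≡ j′
    inject j∈ j′∈ = let 1≤j , j≤ = ∈-range1⁻ j∈ ; 1≤j′ , j′≤ = ∈-range1⁻ j′∈ in injective 1≤j j≤ 1≤j′ j′≤
    D⊆dom : ∀ {d} → d ∈ D → d ∈ dom
    D⊆dom d∈ = let 1≤d , d≤ , _ = D⁻ d∈ in ∈-range1⁺ 1≤d d≤
    tD⊆E : ∀ {d} → d ∈ D → T (elemᵇ (t′ d) E)
    tD⊆E {d} d∈ with T? (elemᵇ (t′ d) E)
    ... | yes h  = h
    ... | no  td∉ =
      let 1≤d , d≤ , ¬sd = D⁻ d∈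
          1≤td , td≤ = bounds 1≤d d≤
          k , 1≤k , k≤ , eq , sk = missing 1≤td td≤ (td∉ ∘ elemᵇ⁺)
      in ⊥-elim (¬sd (subst (λ k → T (s (suc n′ ∸ k))) (sym (injective 1≤d d≤ 1≤k k≤ eq)) sk))
    forward : ∀ x → T (elemᵇ x E ∧ not (elemᵇ x (map t′ D))) → T (not (elemᵇ x (map t′ dom)))
    forward x h = T-not⁺ impossible
      where
      x∈E = elemᵇ⁻ {x} E (proj₁ (to T-∧ h))
      x∉tD = T-not⁻ (proj₂ (to (T-∧ {elemᵇ x E}) h))
      impossible : ¬ T (elemᵇ x (map t′ dom))
      impossible x∈t with k , k∈ , refl ← ∈-map⁻ t′ (elemᵇ⁻ {x} (map t′ dom) x∈t)
        with T? (s (suc n′ ∸ k)) | ∈-range1⁻ k∈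
      ... | yes sk | 1≤k , k≤ = avoids 1≤k k≤ sk x∈E
      ... | no ¬sk | 1≤k , k≤ = x∉tD (elemᵇ⁺ (∈-map⁺ t′ (D⁺ 1≤k k≤ ¬sk)))
    backward : ∀ {x} → x ∈ range1 M → T (not (elemᵇ x (map t′ dom))) → T (elemᵇ x E ∧ not (elemᵇ x (map t′ D)))
    backward {x} x∈ h = from T-∧ (x∈E , T-not⁺ λ x∈tD →
        let d , d∈ , eq = ∈-map⁻ t′ (elemᵇ⁻ {x} (map t′ D) x∈tD)
        in T-not⁻ h (elemᵇ⁺ (subst (_∈ map t′ dom) (sym eq) (∈-map⁺ t′ (D⊆dom d∈)))))
      where
      x∈E : T (elemᵇ x E)
      x∈E with T? (elemᵇ x E)
      ... | yes h  = h
      ... | no x∉E =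
        let 1≤x , x≤M = ∈-range1⁻ x∈
            k , 1≤k , k≤ , eq , _ = missing 1≤x x≤M (x∉E ∘ elemᵇ⁺)
        in ⊥-elim (T-not⁻ h (elemᵇ⁺ (subst (_∈ map t′ dom) (sym eq) (∈-map⁺ t′ (∈-range1⁺ 1≤k k≤)))))

𝒞-powerset : ∀ {m E} → E ∈ powerset (range1 (m ∸ 1)) → sum (𝒞 m E) ≡ m × S (𝒞 m E) ≡ E
𝒞-powerset {m} {E} E∈ = subst (λ F → sum (𝒞 m F) ≡ m × S (𝒞 m F) ≡ F)
  (sym (∈-powerset⇒filterᵇ (range1-unique (m ∸ 1)) E∈)) (sum-𝒞 m (λ x → elemᵇ x E) , S-𝒞 m (λ x → elemᵇ x E))

-- The second reflection, on [m - 1]. With the next lemma: strictness is demanded of W at q exactly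
-- when m - q is missing from E.
∈-S-ω-𝒞⁺ : ∀ {m E q} → E ∈ powerset (range1 (m ∸ 1)) → 1 ≤ q → q < m → m ∸ q ∉ E → q ∈ S (ω (𝒞 m E))
∈-S-ω-𝒞⁺ {m} {E} {q} E∈ 1≤q q<m m∸q∉ with sum≡m , S≡E ← 𝒞-powerset {m} E∈ =
  ∈-S-ω⁺ 1≤q (subst (q <_) (sym sum≡m) q<m) (subst₂ (λ N F → N ∸ q ∉ F) (sym sum≡m) (sym S≡E) m∸q∉)

∈-S-ω-𝒞⁻ : ∀ {m E q} → E ∈ powerset (range1 (m ∸ 1)) → q ∈ S (ω (𝒞 m E)) → m ∸ q ∉ E
∈-S-ω-𝒞⁻ {m} {E} {q} E∈ q∈ with sum≡m , S≡E ← 𝒞-powerset {m} E∈ =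
  subst₂ (λ N F → N ∸ q ∉ F) sum≡m S≡E (proj₂ (proj₂ (∈-S-ω⁻ {𝒞 m E} q∈)))

map-injective-on : {Q : A → Set} (f : A → B) → (∀ {x y} → Q x → Q y → f x ≡ f y → x ≡ y) →
  ∀ {xs ys} → All Q xs → All Q ys → map f xs ≡ map f ys → xs ≡ ys
map-injective-on f inj []       []       _  = refl
map-injective-on f inj (p ∷ ps) (q ∷ qs) eq =
  let fx≡fy , eqs = ∷-injective eq in cong₂ _∷_ (inj p q fx≡fy) (map-injective-on f inj ps qs eqs)

-- The reflection of [n], used on [n - 1] between k and the cut j = n - k, and on [m - 1] between a
-- suffix size and a place in W.
∸-bounds : ∀ {n k} → 1 ≤ k → k ≤ n → 1 ≤ suc n ∸ k × suc n ∸ k ≤ n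
∸-bounds {n} {suc k} _ k<n = m<n⇒0<n∸m k<n , m∸n≤m n k

-- The bijection between partitions and triples

module _ (n′ i : ℕ) (s : ℕ → Bool) (D : List ℕ)
  (D⁺ : ∀ {k} → 1 ≤ k → k ≤ n′ → ¬ T (s (suc n′ ∸ k)) → k ∈ D)
  (D⁻ : ∀ {k} → k ∈ D → 1 ≤ k × k ≤ n′ × ¬ T (s (suc n′ ∸ k)))
  (a : List ℕ) where

  private
    n = suc n′
    m = n + i
    M = n′ + i
    W = expand 1 a

    Emb = Embedding n′ M s
    Fit = Fits n′ M s
    fit = fitting n′ M s

    okT : List ℕ → List ℕ → Bool
    okT = okt n′ M s D D⁺ D⁻

    γ : List ℕ → List ℕ
    γ E = ω (𝒞 m E)

    triples : List (List ℕ × List ℕ × List ℕ)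
    triples = cartesianProduct (powerset (range1 M))
      (cartesianProduct (words n′ (range1 M)) (words m (range1 (length a))))

    okTriple : List ℕ × List ℕ × List ℕ → Bool
    okTriple (E , t , w) = okT E t ∧ okw m (γ E) a w

    triples⁻ : ∀ {E t w} → (E , t , w) ∈ triples →
      E ∈ powerset (range1 M) × t ∈ words n′ (range1 M) × w ∈ words m (range1 (length a))
    triples⁻ h =
      let E∈ , tw∈ = ∈-cartesianProduct⁻ (powerset (range1 M)) _ h
          t∈ , w∈ = ∈-cartesianProduct⁻ (words n′ (range1 M)) _ tw∈
      in E∈ , t∈ , w∈

    okTriple⁻ : ∀ E t w → T (okTriple (E , t , w)) → T (okT E t) × T (okw m (γ E) a w)
    okTriple⁻ E t w = to (T-∧ {okT E t})

  -- For fixed E the product of the two counts is a count of pairs (t, w); the sum over E then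
  -- counts the triples fibre by fibre.
  rhs-count : coeffRHS n i D a ≡ count okTriple triples
  rhs-count = begin
    sum (map (λ E → Tcount n i D E * coeffL (γ E) a) (powerset (range1 M)))
      ≡⟨ cong sum (map-cong-local (All.tabulate λ {E} E∈ → trans
           (cong (Tcount n i D E *_) (coeffL-count (γ E) a (trans (sum-ω (𝒞 m E)) (proj₁ (𝒞-powerset {m} E∈)))))
           (sym (count-× (okT E) (okw m (γ E) a) (words n′ (range1 M)) (words m (range1 (length a))))))) ⟩
    sum (map (λ E → count (λ (t , w) → okT E t ∧ okw m (γ E) a w)
               (cartesianProduct (words n′ (range1 M)) (words m (range1 (length a)))))
             (powerset (range1 M)))
      ≡⟨ count-fibres (λ E (t , w) → okT E t ∧ okw m (γ E) a w) (powerset (range1 M)) _ ⟨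
    count okTriple triples ∎
    where open ≡-Reasoning

  -- An admissible w has m letters and must be W, which has `sum a` letters.
  rhs-degree : sum a ≢ m → count okTriple triples ≡ 0
  rhs-degree sum≢m = count-none triples λ {(E , t , w)} h ok →
    let _ , _ , w∈ = triples⁻ h
        _ , okw-w = okTriple⁻ E t w ok
    in sum≢m (begin
         sum a                 ≡⟨ length-expand 1 a ⟨
         length (expand 1 a)   ≡⟨ cong length (okw⇒≡expand m (γ E) a w∈ okw-w) ⟨
         length w              ≡⟨ proj₁ (∈-words⁻ m {range1 (length a)} w∈) ⟩
         m                     ∎)
    where open ≡-Reasoning

  suffixSizes : List (List ℕ) → List ℕ
  suffixSizes P = map (λ k → rest (n ∸ k) P) (range1 n′)

  nth1-suffixSizes : ∀ P {k} → 1 ≤ k → k ≤ n′ → nth1 0 (suffixSizes P) k ≡ rest (n ∸ k) P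
  nth1-suffixSizes P = nth1-map-range1 0 (λ k → rest (n ∸ k) P)

  module _ (sum-a : sum a ≡ m) where

    private
      |W| : length W ≡ m
      |W| = trans (length-expand 1 a) sum-a

    -- As no part is empty, suffix sizes grow strictly from 0 for no parts to m for all n parts, so
    -- the intermediate ones lie in [m - 1].
    Valid⇒Embedding : ∀ {σ} → Valid n s a σ → Emb (suffixSizes (pieces σ))
    Valid⇒Embedding {σ} v = record
      { size = trans (length-map _ (range1 n′)) (length-range1 n′)
      ; bounds = λ {k} 1≤k k≤ → subst (λ x → 1 ≤ x × x ≤ M) (sym (nth1-suffixSizes P 1≤k k≤)) (bound 1≤k k≤)
      ; monotone = λ {k} {k′} 1≤k k<k′ k′≤ → subst₂ _<_
          (sym (nth1-suffixSizes P 1≤k (≤-trans (<⇒≤ k<k′) k′≤)))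
          (sym (nth1-suffixSizes P (≤-trans 1≤k (<⇒≤ k<k′)) k′≤))
          (rest-descending nonempty (∸-monoʳ-< k<k′ (m≤n⇒m≤1+n k′≤)) (subst (n ∸ k ≤_) (sym |P|) (m∸n≤m n k)))
      }
      where
      open Valid v
      P = pieces σ
      |P| : length P ≡ n
      |P| = trans (length-map (expand 1) σ) size
      bound : ∀ {k} → 1 ≤ k → k ≤ n′ → 1 ≤ rest (n ∸ k) P × rest (n ∸ k) P ≤ M
      bound {k} 1≤k k≤ =
        let 1≤j , j≤ = ∸-bounds 1≤k k≤ in
        subst (_< rest (n ∸ k) P) (rest-length P)
          (rest-descending nonempty (subst (n ∸ k <_) (sym |P|) (s≤s j≤)) ≤-refl) ,
        s≤s⁻¹ (subst (rest (n ∸ k) P <_) (trans (cong length content) |W|)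
          (rest-descending nonempty 1≤j (subst (n ∸ k ≤_) (sym |P|) (m≤n⇒m≤1+n j≤))))

    -- Where no strictness is demanded, W is sorted anyway. Where it is, m - q is missing from E,
    -- hence is t(k) with n - k in the descent set, and q is the place of a cut at which σ ascends
    -- strictly.
    Valid⇒okw : ∀ {σ E} → Valid n s a σ → Fit (suffixSizes (pieces σ)) E → T (okw m (γ E) a W)
    Valid⇒okw {σ} {E} v fits = okw-expand m (γ E) a step
      where
      open Valid v
      open Fits fits
      P = pieces σ
      step : ∀ {q} → 1 ≤ q → q ≤ M → T (stepᵇ (elemᵇ q (S (γ E))) (nth1 0 W q) (nth1 0 W (suc q)))
      step {q} 1≤q q≤M with T? (elemᵇ q (S (γ E)))
      ... | no ¬q∈ = ≤⇒stepᵇ (elemᵇ q (S (γ E))) ¬q∈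
        (Sorted⇒nth1-≤ (expand-sorted 1 a) 1≤q (subst (q <_) (sym |W|) (s≤s q≤M)))
      ... | yes q∈ with k , 1≤k , k≤ , eq , sk ← missing (proj₁ (∸-bounds 1≤q q≤M)) (proj₂ (∸-bounds 1≤q q≤M))
                         (∈-S-ω-𝒞⁻ {m} subset (elemᵇ⁻ {q} (S (γ E)) q∈)) =
        stepᵇ-mono (elemᵇ q (S (γ E))) (s j) {nth1 0 W q} {nth1 0 W (suc q)} (λ _ → sk)
          (subst₂ (λ x y → T (stepᵇ (s j) x y)) (sym (proj₁ at-boundary)) (sym (proj₂ at-boundary))
            (boundary 1≤j j≤))
        where
        j = n ∸ k
        1≤j = proj₁ (∸-bounds 1≤k k≤)
        j≤ = proj₂ (∸-bounds 1≤k k≤)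
        q≡ : length (concat P) ∸ rest j P ≡ q
        q≡ = begin
          length (concat P) ∸ rest j P  ≡⟨ cong₂ _∸_ (trans (cong length content) |W|)
                                             (trans (sym (nth1-suffixSizes P 1≤k k≤)) (sym eq)) ⟩
          m ∸ (m ∸ q)                   ≡⟨ m∸[m∸n]≡n (m≤n⇒m≤1+n q≤M) ⟩
          q                             ∎
          where open ≡-Reasoning
        at-boundary : nth1 0 W q ≡ last₀ (nth1 [] P j) × nth1 0 W (suc q) ≡ head₀ (nth1 [] P (suc j))
        at-boundary = subst₂ (λ w q → nth1 0 w q ≡ last₀ (nth1 [] P j) × nth1 0 w (suc q) ≡ head₀ (nth1 [] P (suc j)))
          content q≡ (nth1-concat-rest nonempty 1≤j
            (subst (j <_) (sym (trans (length-map (expand 1) σ) size)) (s≤s j≤)))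

    -- Both partitions cut the same word W, at places read off from the suffix sizes; equal widths
    -- then recover the multiplicity lists.
    suffixSizes-injective : ∀ {σ τ} → Valid n s a σ → Valid n s a τ →
      suffixSizes (pieces σ) ≡ suffixSizes (pieces τ) → σ ≡ τ
    suffixSizes-injective {σ} {τ} v v′ eq = map-injective-on (expand 1)
      (λ |b| |c| → expand-injective (trans |b| (sym |c|))) (Valid.widths v) (Valid.widths v′)
      (concat-injective (trans |P| (sym |Q|)) (trans (Valid.content v) (sym (Valid.content v′))) same)
      where
      P = pieces σ
      Q = pieces τ
      |P| : length P ≡ n
      |P| = trans (length-map (expand 1) σ) (Valid.size v)
      |Q| : length Q ≡ n
      |Q| = trans (length-map (expand 1) τ) (Valid.size v′)
      same : ∀ {j} → 1 ≤ j → j < length P → rest j P ≡ rest j Q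
      same {j} 1≤j j< = subst (λ j → rest j P ≡ rest j Q) (m∸[m∸n]≡n (m≤n⇒m≤1+n j≤n′))
        (trans (sym (nth1-suffixSizes P 1≤k k≤)) (trans (cong (λ t → nth1 0 t (n ∸ j)) eq) (nth1-suffixSizes Q 1≤k k≤)))
        where
        j≤n′ = s≤s⁻¹ (subst (j <_) |P| j<)
        1≤k = proj₁ (∸-bounds 1≤j j≤n′)
        k≤ = proj₂ (∸-bounds 1≤j j≤n′)

    module _ {t E : List ℕ} (emb : Emb t) (fits : Fit t E) (okW : T (okw m (γ E) a W)) where
      private
        open Embedding emb
        open Fits fits

        -- The default value of `nth1` acts as t(0) = 0, the size of the empty suffix.
        t₀ : nth1 0 t 0 ≡ 0
        t₀ = nth1-zero 0 t

        -- `u j` is t(n - j), extended by t(n) = m; index 0 is separate because `nth1` would read 0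
        -- beyond the end of `t`.
        u : ℕ → ℕ
        u zero    = m
        u (suc j) = nth1 0 t (n′ ∸ j)

        t≤M : ∀ {k} → k ≤ n′ → nth1 0 t k ≤ M
        t≤M {zero}  _  = subst (_≤ M) (sym t₀) z≤n
        t≤M {suc k} k≤ = proj₂ (bounds (s≤s z≤n) k≤)

        t-increasing : ∀ {k k′} → k < k′ → k′ ≤ n′ → nth1 0 t k < nth1 0 t k′
        t-increasing {zero} {k′} k<k′ k′≤ = subst (_< nth1 0 t k′) (sym t₀) (proj₁ (bounds k<k′ k′≤))
        t-increasing {suc k} k<k′ k′≤ = monotone (s≤s z≤n) k<k′ k′≤

        u-descends : ∀ {j} → j < n → u (suc j) < u j
        u-descends {zero}  _         = s≤s (t≤M ≤-refl)
        u-descends {suc j} (s≤s j<n′) = t-increasing (∸-monoʳ-< ≤-refl j<n′) (m∸n≤m n′ j)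

        cut : ∃ λ P → length P ≡ n × concat P ≡ W × All Nonempty P × (∀ {j} → j ≤ n → rest j P ≡ u j)
        cut = split n u W (sym |W|) (trans (cong (nth1 0 t) (n∸n≡0 n′)) t₀) u-descends

        P = proj₁ cut
        |P| = proj₁ (proj₂ cut)
        concat-P = proj₁ (proj₂ (proj₂ cut))
        P-nonempty = proj₁ (proj₂ (proj₂ (proj₂ cut)))
        rest-P : ∀ {j} → j ≤ n → rest j P ≡ u j
        rest-P = proj₂ (proj₂ (proj₂ (proj₂ cut)))

        σ : List (List ℕ)
        σ = map (multiplicities (length a)) P

        pieces-σ : pieces σ ≡ P
        pieces-σ = trans (sym (map-∘ P)) (map-id-local (All.zipWith (λ (s , ⊆) → expand-multiplicities s ⊆)
          ( Sorted-concat⁻ P (subst Sorted (sym concat-P) (expand-sorted 1 a))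
          , All.concat⁻ {xss = P} (subst (All (_∈ range1 (length a))) (sym concat-P) (expand⊆range1 a)))))

        rest-t : ∀ {k} → 1 ≤ k → k ≤ n′ → rest (n ∸ k) P ≡ nth1 0 t k
        rest-t {k} 1≤k k≤ = begin
          rest (n ∸ k) P             ≡⟨ rest-P (m∸n≤m n k) ⟩
          u (n ∸ k)                  ≡⟨ cong u (∸-suc k≤) ⟩
          nth1 0 t (n′ ∸ (n′ ∸ k))   ≡⟨ cong (nth1 0 t) (m∸[m∸n]≡n k≤) ⟩
          nth1 0 t k                 ∎
          where
          open ≡-Reasoning
          ∸-suc : k ≤ n′ → suc n′ ∸ k ≡ suc (n′ ∸ k)
          ∸-suc = +-∸-assoc 1

        -- If strictness is demanded at j, then k = n - j is outside D, so t(k) is missing from E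
        -- and W ascends strictly at q = m - t(k), which is the place of the j-th cut.
        P-boundary : ∀ {j} → 1 ≤ j → j ≤ n′ → T (stepᵇ (s j) (last₀ (nth1 [] P j)) (head₀ (nth1 [] P (suc j))))
        P-boundary {j} 1≤j j≤ = stepᵇ-mono (s j) (elemᵇ q (S (γ E))) {last₀ (nth1 [] P j)} {head₀ (nth1 [] P (suc j))} strict
          (subst₂ (λ x y → T (stepᵇ (elemᵇ q (S (γ E))) x y)) (proj₁ at-boundary) (proj₂ at-boundary)
            (okw⇒step m (γ E) a {W} okW (proj₁ q-bounds) (proj₂ q-bounds)))
          where
          k = n ∸ j
          1≤k = proj₁ (∸-bounds 1≤j j≤)
          k≤ = proj₂ (∸-bounds 1≤j j≤)
          n∸k : n ∸ k ≡ j
          n∸k = m∸[m∸n]≡n (m≤n⇒m≤1+n j≤)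
          tk = nth1 0 t k
          q = m ∸ tk
          q-bounds : 1 ≤ q × q ≤ M
          q-bounds = let 1≤tk , tk≤ = bounds 1≤k k≤ in ∸-bounds 1≤tk tk≤
          strict : T (s j) → T (elemᵇ q (S (γ E)))
          strict sj = elemᵇ⁺ (∈-S-ω-𝒞⁺ {m} subset (proj₁ q-bounds) (s≤s (proj₂ q-bounds))
            (subst (_∉ E) (sym (m∸[m∸n]≡n (m≤n⇒m≤1+n (proj₂ (bounds 1≤k k≤)))))
              (avoids 1≤k k≤ (subst (T ∘ s) (sym n∸k) sj))))
          at-boundary : nth1 0 W q ≡ last₀ (nth1 [] P j) × nth1 0 W (suc q) ≡ head₀ (nth1 [] P (suc j))
          at-boundary = subst₂ (λ w q → nth1 0 w q ≡ last₀ (nth1 [] P j) × nth1 0 w (suc q) ≡ head₀ (nth1 [] P (suc j)))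
            concat-P
            (cong₂ _∸_ (trans (cong length concat-P) |W|)
              (trans (cong (λ j → rest j P) (sym n∸k)) (rest-t 1≤k k≤)))
            (nth1-concat-rest P-nonempty 1≤j (subst (j <_) (sym |P|) (s≤s j≤)))

      suffixSizes-surjective : ∃ λ σ → Valid n s a σ × suffixSizes (pieces σ) ≡ t
      suffixSizes-surjective = σ , record
          { size = trans (length-map _ P) |P|
          ; widths = All.map⁺ (All.universal (length-multiplicities (length a)) P)
          ; nonempty = subst (All Nonempty) (sym pieces-σ) P-nonempty
          ; boundary = λ {j} 1≤j j≤ → subst
              (λ P → T (stepᵇ (s j) (last₀ (nth1 [] P j)) (head₀ (nth1 [] P (suc j)))))
              (sym pieces-σ) (P-boundary 1≤j j≤)
          ; content = trans (cong concat pieces-σ) concat-P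
          } ,
        trans (cong suffixSizes pieces-σ) (nth1-ext 0 (trans |sizes| (sym size)) λ {k} 1≤k k≤ →
          let k≤n′ = subst (k ≤_) |sizes| k≤
          in trans (nth1-suffixSizes P 1≤k k≤n′) (rest-t 1≤k k≤n′))
        where
        |sizes| : length (suffixSizes P) ≡ n′
        |sizes| = trans (length-map _ (range1 n′)) (length-range1 n′)

    private
      triple : List (List ℕ) → List ℕ × List ℕ × List ℕ
      triple σ = fit (suffixSizes (pieces σ)) , suffixSizes (pieces σ) , W

      W∈words : W ∈ words m (range1 (length a))
      W∈words = subst (λ k → W ∈ words k (range1 (length a))) |W| (∈-words⁺ (expand⊆range1 a))

      triples-unique = Unique.cartesianProduct⁺ (powerset-unique (range1-unique M))
        (Unique.cartesianProduct⁺ (words-unique n′ (range1-unique M)) (words-unique m (range1-unique (length a))))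

    lhs-count : count (okσ n s a) (words n (boxes a)) ≡ count okTriple triples
    lhs-count = count-bijection (words-unique n (boxes-unique a)) triples-unique triple
      (λ {σ} σ∈ ok →
        let v = okσ⇒Valid n s a σ∈ ok
            t = suffixSizes (pieces σ)
            fits = fitting-Fits n′ M s t
            t∈ , ok-t = okt⇐ n′ M s D D⁺ D⁻ (Valid⇒Embedding v) fits
        in ∈-cartesianProduct⁺ (Fits.subset fits) (∈-cartesianProduct⁺ t∈ W∈words) ,
           from T-∧ (ok-t , Valid⇒okw v fits))
      -- The component t alone already determines σ.
      (λ σ∈ ok τ∈ ok′ eq → suffixSizes-injective (okσ⇒Valid n s a σ∈ ok) (okσ⇒Valid n s a τ∈ ok′)
        (cong (proj₁ ∘ proj₂) eq))
      λ {(E , t , w)} h ok →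
        let E∈ , t∈ , w∈ = triples⁻ h
            ok-t , ok-w = okTriple⁻ E t w ok
            emb , fits = okt⇒ n′ M s D D⁺ D⁻ t∈ E∈ ok-t
            w≡W = okw⇒≡expand m (γ E) a w∈ ok-w
            σ , v , t≡ = suffixSizes-surjective emb fits (subst (T ∘ okw m (γ E) a) w≡W ok-w)
            σ∈ , ok-σ = Valid⇒okσ n s a v
            -- The given E need not have been built by `fit`, but only one set fits t.
            fit≡E = Fits-unique n′ M s (fitting-Fits n′ M s t) fits
        in σ , σ∈ , ok-σ , cong₂ _,_ (trans (cong fit t≡) fit≡E) (cong₂ _,_ t≡ (sym w≡W))

  -- In degrees other than m, the left side vanishes by its test and the right side by `rhs-degree`.
  expansion : (if sum a ≡ᵇ m then count (okσ n s a) (words n (boxes a)) else 0) ≡ coeffRHS n i D a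
  expansion with sum a ≡ᵇ m in eq
  ... | true  = trans (lhs-count (≡ᵇ⇒≡ (sum a) m (subst T (sym eq) _))) (sym rhs-count)
  ... | false = sym (trans rhs-count (rhs-degree λ sum≡m → subst T eq (≡⇒≡ᵇ (sum a) m sum≡m)))

theorem5p1 : (n : ℕ) → 1 ≤ n → (α : List ℕ) → All (0 <_) α → sum α ≡ n →
    (i : ℕ) → (a : List ℕ) →
    coeffLhatDeg i α a ≡ coeffRHS n i (S (ω α)) a
theorem5p1 (suc n′) _ α _ |α| i a = trans
  -- Replaces `sum α` by n in the degree test and in the number of parts.
  (cong (λ n → if sum a ≡ᵇ (n + i) then count (okσ n s a) (words n (boxes a)) else 0) |α|)
  (expansion n′ i s (S (ω α)) D⁺ D⁻ a)
  where
  s : ℕ → Bool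
  s j = elemᵇ j (S α)
  -- The first reflection, on [n - 1]: k belongs to D exactly when n - k is not a descent of α.
  D⁺ : ∀ {k} → 1 ≤ k → k ≤ n′ → ¬ T (s (suc n′ ∸ k)) → k ∈ S (ω α)
  D⁺ {k} 1≤k k≤ ¬sk = ∈-S-ω⁺ 1≤k (subst (k <_) (sym |α|) (s≤s k≤))
    (subst (λ n → n ∸ k ∉ S α) (sym |α|) (¬sk ∘ elemᵇ⁺))
  D⁻ : ∀ {k} → k ∈ S (ω α) → 1 ≤ k × k ≤ n′ × ¬ T (s (suc n′ ∸ k))
  D⁻ {k} k∈ = let 1≤k , k< , k∉ = ∈-S-ω⁻ {α} k∈ in
    1≤k , s≤s⁻¹ (subst (k <_) |α| k<) ,
    subst (λ n → ¬ T (s (n ∸ k))) |α| (k∉ ∘ elemᵇ⁻ (S α))
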